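{- For a positive integer $t$ let $p_t(n)$ be defined by $\sum_{n\ge 0}p_t(n)q^n=\prod_{i\ge 1}(1-q^i)^{ -t}$. Then the congruence of formal power series $$q^2\sum_{n=0}^\infty p_t(a^2n+b)q^n\equiv \frac{1}{\prod_{i=1}^{\infty}(1-q^i)^{a^2t}}+\frac{1}{\prod_{i=1}^{\infty}(1-q^{ai})^{at}}+\frac{q}{\prod_{i=1}^{\infty}(1-q^i)^{t}}\pmod 2$$ holds for both triples $(a,b,t)=(3,8,3)$ and $(a,b,t)=(5,24,1)$.
   Context: Two power series $\sum a(n)q^n$ and $\sum b(n)q^n$ (with integer coefficients) are congruent modulo $2$ if $a(n)\equiv b(n)\pmod 2$ for every integer $n$. -}

module Defs where

open import Data.Nat using (ℕ; zero; suc; _+_; _*_; _∸_; _^_; _%_)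
open import Data.Nat.Divisibility using (_∣?_)
open import Data.Bool using (if_then_else_)
open import Data.Product using (_×_)
open import Relation.Nullary.Decidable using (⌊_⌋)
open import Relation.Binary.PropositionalEquality using (_≡_)

-- Formal power series in q with natural-number coefficients:
-- a series f represents  Σ_{n ≥ 0} f n qⁿ.
Series : Set
Series = ℕ → ℕ

one : Series
one zero    = 1
one (suc _) = 0

sumUpTo : ℕ → (ℕ → ℕ) → ℕ
sumUpTo zero    h = h 0
sumUpTo (suc m) h = sumUpTo m h + h (suc m)

_⋆_ : Series → Series → Series
(f ⋆ g) n = sumUpTo n (λ k → f k * g (n ∸ k))

pow : Series → ℕ → Series
pow f zero    = one
pow f (suc t) = f ⋆ pow f t

-- geometric series 1 / (1 - q^d) = Σ_k q^{d k}   (used only for d ≥ 1)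
geom : ℕ → Series
geom d n = if ⌊ d ∣? n ⌋ then 1 else 0

truncInvProd : ℕ → ℕ → ℕ → Series
truncInvProd zero    a t = one
truncInvProd (suc N) a t = truncInvProd N a t ⋆ pow (geom (a * suc N)) t

-- the infinite product  ∏_{i ≥ 1} (1 - q^{a i})^{-t}  for a ≥ 1:
-- its n-th coefficient agrees with that of the truncation at N = n,
-- since the factors with i > n are ≡ 1 modulo q^{n+1}.
invProd : ℕ → ℕ → Series
invProd a t n = truncInvProd n a t n

p : ℕ → ℕ → ℕ
p t n = invProd 1 t n

shift : ℕ → Series → Series
shift zero    f n       = f n
shift (suc s) f zero    = 0
shift (suc s) f (suc n) = shift s f n

_⊕_ : Series → Series → Series
(f ⊕ g) n = f n + g n

_≡[mod2]_ : Series → Series → Set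
f ≡[mod2] g = ∀ n → f n % 2 ≡ g n % 2

Congruence : ℕ → ℕ → ℕ → Set
Congruence a b t =
  shift 2 (λ n → p t (a ^ 2 * n + b))
    ≡[mod2] ((invProd 1 (a ^ 2 * t) ⊕ invProd a (a * t)) ⊕ shift 1 (invProd 1 t))

{-# OPTIONS --safe #-}
module Submission where

-- Work in 𝔽₂⟦q⟧ with E = ∏ (1 + qⁱ).  The Jacobi triple product modulo 2 gives Euler's
-- E = ∑ q^(k(3k-1)/2) (k ∈ ℤ) and Jacobi's E³ = ∑ q^(k(k+1)/2) (k ≥ 0).  Put X = E³ if a = 3, X = E if
-- a = 5, and Y(q) = X(qᵃ).  Dissecting these theta series modulo a shows that
-- D = X^(a+1) + XY + qY^(a+1) satisfies D(q) = q D(qᵃ), so D = 0.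
-- For a = 5 this needs two relations for E = A(q⁵) + q E(q²⁵) + q² C(q⁵): AC = Y², because no
-- triangular number is 2 modulo 5, and A⁵ + q²C⁵ = E, which comes from multiplying the
-- sections 0 and 1 of E³, two theta series whose product is E(q) E(q⁵).
-- Let h = 1/X and let Sⱼ be the section of hʲ in the class -j modulo a.  Multiplying D = 0 by
-- powers of h gives by recursion on j that q Yʲ Sⱼ = 1 + (Y hᵃ)ʲ; the case j = a and one more
-- section of D = 0 yield the congruence.

open import Defs
open import Algebra.Bundles using (CommutativeRing; CommutativeSemiring)
open import Algebra.Structures using (IsCommutativeMonoid)
open import Algebra.Solver.Ring.AlmostCommutativeRing using (AlmostCommutativeRing; fromCommutativeSemiring; _-Raw-AlmostCommutative⟶_)
import Algebra.Solver.Ring as RingSolver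
open import Data.Bool using (Bool; true; false; _∧_; _xor_; not; if_then_else_)
open import Data.Bool.Properties using (∧-comm; ∧-assoc; ∧-zeroʳ; ∧-distribˡ-xor; ∧-distribʳ-xor; xor-assoc; xor-comm; xor-identityʳ; xor-same; xor-∧-commutativeRing; not-involutive; not-distribˡ-xor)
open import Data.Fin using (#_; zero; suc)
open import Data.List as List using (List; []; _∷_; length)
open import Data.Maybe using (just; nothing)
open import Data.Nat as ℕ using (ℕ; zero; suc; _≤_; _<_; z≤n; s≤s; NonZero)
open import Data.Nat.DivMod using (m≡m%n+[m/n]*n; m%n<n; m/n≤m)
open import Data.Nat.Divisibility using (_∣?_; ∣m+n∣m⇒∣n; ∣m∣n⇒∣m+n; ∣-refl; _∣0; >⇒∤)
import Data.Nat.Properties as ℕₚ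
import Data.Nat.Solver
open import Data.Product using (_×_; _,_)
open import Data.Sum using (inj₁; inj₂)
open import Data.Vec using (Vec; []; _∷_; lookup)
open import Function using (_∘_)
open import Level using (0ℓ)
open import Relation.Binary.PropositionalEquality as ≡ using (_≡_; cong; cong₂; module ≡-Reasoning)
open import Relation.Binary.Definitions using (WeaklyDecidable)
import Relation.Binary.Reasoning.Setoid as SetoidReasoning
open import Relation.Binary.Structures using (IsEquivalence)
open import Relation.Nullary using (contradiction)
open import Relation.Nullary.Decidable using (yes; no)

-- The recursion closes because residue classes match. The part of X in class 1 modulo a is q Y(qᵃ),
-- and class m of Xᵐ is exactly Yᵐ for 0 < m < a, the other contributions cancelling modulo 2 or
-- falling into other classes. Multiplying D = 0 by hⁿ⁺¹ gives q Yᵃ⁺¹ hⁿ⁺¹ = Xᵐ + Y hⁿ with m = a -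
-- n. As Y is a series in qᵃ, it leaves a section as a factor X, so class m of this equation
-- expresses class -(n+1) of hⁿ⁺¹ through class -n of hⁿ and the known class m of Xᵐ. In both
-- triples b = a² - 1, so the coefficients at a²n + b are reached by taking class a - 1 modulo a
-- twice. The generating function of p_t is h modulo 2, because 1 - qⁱ and 1 + qⁱ agree there.

𝔽₂⟦q⟧ : Set
𝔽₂⟦q⟧ = ℕ → Bool

-- Power series over 𝔽₂ and congruence modulo powers of q

infix 4 _≈_ _≈[_]_
infixl 6 _+_
infixl 7 _*_

record _≈_ (f g : 𝔽₂⟦q⟧) : Set where
  constructor coeffwise
  field coeff : ∀ n → f n ≡ g n
open _≈_

-- Congruence modulo qᴺ. Limits are handled by proving it for every N and passing to equality with
-- `≈[]⇒≈`.
record _≈[_]_ (f : 𝔽₂⟦q⟧) (N : ℕ) (g : 𝔽₂⟦q⟧) : Set where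
  constructor coeffwise
  field coeff-< : ∀ n → n < N → f n ≡ g n
open _≈[_]_

abstract
  0# 1# q : 𝔽₂⟦q⟧
  0# _ = false
  1# zero    = true
  1# (suc _) = false
  q zero    = false
  q (suc n) = 1# n

  _+_ _*_ : 𝔽₂⟦q⟧ → 𝔽₂⟦q⟧ → 𝔽₂⟦q⟧
  (f + g) n = f n xor g n
  -- With f = f₀ + q f′ the product is f₀ g + q f′ g, which gives a recursion on the index of the
  -- coefficient.
  (f * g) zero    = f 0 ∧ g 0
  (f * g) (suc n) = (f 0 ∧ g (suc n)) xor ((f ∘ suc) * g) n

  0#-coeff : ∀ n → 0# n ≡ false
  0#-coeff n = ≡.refl

  1#-coeff₀ : 1# 0 ≡ true
  1#-coeff₀ = ≡.refl

  1#-coeff₊ : ∀ n → 1# (suc n) ≡ false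
  1#-coeff₊ n = ≡.refl

  +-coeff : ∀ f g n → (f + g) n ≡ f n xor g n
  +-coeff f g n = ≡.refl

  *-coeff₀ : ∀ f g → (f * g) 0 ≡ f 0 ∧ g 0
  *-coeff₀ f g = ≡.refl

  *-coeff₊ : ∀ f g n → (f * g) (suc n) ≡ (f 0 ∧ g (suc n)) xor ((f ∘ suc) * g) n
  *-coeff₊ f g n = ≡.refl

  *-local : ∀ {f f′ g g′} n → (∀ k → k ≤ n → f k ≡ f′ k) → (∀ k → k ≤ n → g k ≡ g′ k) →
            (f * g) n ≡ (f′ * g′) n
  *-local zero    p r = cong₂ _∧_ (p 0 z≤n) (r 0 z≤n)
  *-local (suc n) p r = cong₂ _xor_ (cong₂ _∧_ (p 0 z≤n) (r (suc n) ℕₚ.≤-refl))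
    (*-local n (λ k k≤n → p (suc k) (s≤s k≤n)) (λ k k≤n → r k (ℕₚ.m≤n⇒m≤1+n k≤n)))

  0*-coeff : ∀ g n → (0# * g) n ≡ false
  0*-coeff g zero    = ≡.refl
  0*-coeff g (suc n) = 0*-coeff g n

  1*-coeff : ∀ g n → (1# * g) n ≡ g n
  1*-coeff g zero    = ≡.refl
  1*-coeff g (suc n) = ≡.trans (cong (g (suc n) xor_) (0*-coeff g n)) (xor-identityʳ _)

  q*-coeff₀ : ∀ f → (q * f) 0 ≡ false
  q*-coeff₀ f = ≡.refl

  q*-coeff₊ : ∀ f n → (q * f) (suc n) ≡ f n
  q*-coeff₊ f n = 1*-coeff f n

  xor-interchange : ∀ a b c d → (a xor b) xor (c xor d) ≡ (a xor c) xor (b xor d)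
  xor-interchange a b c d = begin
    (a xor b) xor (c xor d) ≡⟨ xor-assoc a b _ ⟩
    a xor (b xor (c xor d)) ≡⟨ cong (a xor_) (xor-assoc b c d) ⟨
    a xor ((b xor c) xor d) ≡⟨ cong (λ e → a xor (e xor d)) (xor-comm b c) ⟩
    a xor ((c xor b) xor d) ≡⟨ cong (a xor_) (xor-assoc c b d) ⟩
    a xor (c xor (b xor d)) ≡⟨ xor-assoc a c _ ⟨
    (a xor c) xor (b xor d) ∎
    where open ≡-Reasoning

  -- The mirror image of the defining recursion, splitting g = g₀ + q g′ instead of f; commutativity
  -- and cancellation rest on it.
  *-coeff₊′ : ∀ f g n → (f * g) (suc n) ≡ (f * (g ∘ suc)) n xor (f (suc n) ∧ g 0)
  *-coeff₊′ f g zero    = ≡.refl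
  *-coeff₊′ f g (suc n) =
    ≡.trans (cong ((f 0 ∧ g (suc (suc n))) xor_) (*-coeff₊′ (f ∘ suc) g n)) (≡.sym (xor-assoc (f 0 ∧ g (suc (suc n))) _ _))

  *-comm-coeff : ∀ f g n → (f * g) n ≡ (g * f) n
  *-comm-coeff f g zero    = ∧-comm (f 0) (g 0)
  *-comm-coeff f g (suc n) = begin
    (f 0 ∧ g (suc n)) xor ((f ∘ suc) * g) n ≡⟨ cong₂ _xor_ (∧-comm (f 0) _) (*-comm-coeff (f ∘ suc) g n) ⟩
    (g (suc n) ∧ f 0) xor (g * (f ∘ suc)) n ≡⟨ xor-comm (g (suc n) ∧ f 0) _ ⟩
    (g * (f ∘ suc)) n xor (g (suc n) ∧ f 0) ≡⟨ *-coeff₊′ g f n ⟨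
    (g * f) (suc n)                         ∎
    where open ≡-Reasoning

  *-distribʳ-coeff : ∀ h f g n → ((f + g) * h) n ≡ (f * h) n xor (g * h) n
  *-distribʳ-coeff h f g zero    = ∧-distribʳ-xor (h 0) (f 0) (g 0)
  *-distribʳ-coeff h f g (suc n) = ≡.trans
    (cong₂ _xor_ (∧-distribʳ-xor (h (suc n)) (f 0) (g 0)) (*-distribʳ-coeff h (f ∘ suc) (g ∘ suc) n))
    (xor-interchange (f 0 ∧ h (suc n)) _ _ _)

  scale-* : ∀ c g h n → ((λ k → c ∧ g k) * h) n ≡ c ∧ (g * h) n
  scale-* c g h zero    = ∧-assoc c (g 0) (h 0)
  scale-* c g h (suc n) = ≡.trans
    (cong₂ _xor_ (∧-assoc c (g 0) (h (suc n))) (scale-* c (g ∘ suc) h n))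
    (≡.sym (∧-distribˡ-xor c _ _))

  *-assoc-coeff : ∀ f g h n → ((f * g) * h) n ≡ (f * (g * h)) n
  *-assoc-coeff f g h zero    = ∧-assoc (f 0) (g 0) (h 0)
  *-assoc-coeff f g h (suc n) = begin
    ((f 0 ∧ g 0) ∧ h (suc n)) xor (((λ k → f 0 ∧ g (suc k)) + ((f ∘ suc) * g)) * h) n
      ≡⟨ cong₂ _xor_ (∧-assoc (f 0) (g 0) _) (*-distribʳ-coeff h (λ k → f 0 ∧ g (suc k)) _ n) ⟩
    (f 0 ∧ g 0 ∧ h (suc n)) xor (((λ k → f 0 ∧ g (suc k)) * h) n xor (((f ∘ suc) * g) * h) n)
      ≡⟨ cong ((f 0 ∧ g 0 ∧ h (suc n)) xor_) (cong₂ _xor_ (scale-* (f 0) (g ∘ suc) h n) (*-assoc-coeff (f ∘ suc) g h n)) ⟩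
    (f 0 ∧ g 0 ∧ h (suc n)) xor ((f 0 ∧ ((g ∘ suc) * h) n) xor ((f ∘ suc) * (g * h)) n)
      ≡⟨ xor-assoc (f 0 ∧ g 0 ∧ h (suc n)) _ _ ⟨
    ((f 0 ∧ g 0 ∧ h (suc n)) xor (f 0 ∧ ((g ∘ suc) * h) n)) xor ((f ∘ suc) * (g * h)) n
      ≡⟨ cong (_xor ((f ∘ suc) * (g * h)) n) (∧-distribˡ-xor (f 0) _ _) ⟨
    (f 0 ∧ (g * h) (suc n)) xor ((f ∘ suc) * (g * h)) n ∎
    where open ≡-Reasoning

≈-isEquivalence : IsEquivalence _≈_
≈-isEquivalence = record
  { refl  = coeffwise λ n → ≡.refl
  ; sym   = λ p → coeffwise λ n → ≡.sym (coeff p n)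
  ; trans = λ p r → coeffwise λ n → ≡.trans (coeff p n) (coeff r n)
  }

≈[]-sym : ∀ {N f g} → f ≈[ N ] g → g ≈[ N ] f
≈[]-sym p = coeffwise λ n n<N → ≡.sym (coeff-< p n n<N)

≈[]-trans : ∀ {N f g h} → f ≈[ N ] g → g ≈[ N ] h → f ≈[ N ] h
≈[]-trans p r = coeffwise λ n n<N → ≡.trans (coeff-< p n n<N) (coeff-< r n n<N)

≈⇒≈[] : ∀ {N f g} → f ≈ g → f ≈[ N ] g
≈⇒≈[] p = coeffwise λ n _ → coeff p n

≈[]⇒≈ : ∀ {f g} → (∀ N → f ≈[ N ] g) → f ≈ g
≈[]⇒≈ p = coeffwise λ n → coeff-< (p (suc n)) n ℕₚ.≤-refl

≈[]-weaken : ∀ {m n f g} → m ≤ n → f ≈[ n ] g → f ≈[ m ] g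
≈[]-weaken m≤n p = coeffwise λ k k<m → coeff-< p k (ℕₚ.<-≤-trans k<m m≤n)

+-cong-[] : ∀ {N f f′ g g′} → f ≈[ N ] f′ → g ≈[ N ] g′ → f + g ≈[ N ] f′ + g′
+-cong-[] p r = coeffwise λ n n<N →
  ≡.trans (+-coeff _ _ n) (≡.trans (cong₂ _xor_ (coeff-< p n n<N) (coeff-< r n n<N)) (≡.sym (+-coeff _ _ n)))

*-cong-[] : ∀ {N f f′ g g′} → f ≈[ N ] f′ → g ≈[ N ] g′ → f * g ≈[ N ] f′ * g′
*-cong-[] p r = coeffwise λ n n<N → *-local n
  (λ k k≤n → coeff-< p k (ℕₚ.≤-<-trans k≤n n<N)) (λ k k≤n → coeff-< r k (ℕₚ.≤-<-trans k≤n n<N))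

abstract
  +-comm-≈ : ∀ f g → f + g ≈ g + f
  +-comm-≈ f g = coeffwise λ n → xor-comm (f n) (g n)

  +-isCommutativeMonoid : IsCommutativeMonoid _≈_ _+_ 0#
  +-isCommutativeMonoid = record
    { isMonoid = record
      { isSemigroup = record
        { isMagma = record { isEquivalence = ≈-isEquivalence
                           ; ∙-cong = λ p r → ≈[]⇒≈ λ N → +-cong-[] (≈⇒≈[] p) (≈⇒≈[] r) }
        ; assoc = λ f g h → coeffwise λ n → xor-assoc (f n) (g n) (h n) }
      ; identity = (λ f → coeffwise λ n → ≡.refl) , λ f → coeffwise λ n → xor-identityʳ (f n) }
    ; comm = +-comm-≈ }

  *-isCommutativeMonoid : IsCommutativeMonoid _≈_ _*_ 1#
  *-isCommutativeMonoid = record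
    { isMonoid = record
      { isSemigroup = record
        { isMagma = record { isEquivalence = ≈-isEquivalence
                           ; ∙-cong = λ p r → ≈[]⇒≈ λ N → *-cong-[] (≈⇒≈[] p) (≈⇒≈[] r) }
        ; assoc = λ f g h → coeffwise (*-assoc-coeff f g h) }
      ; identity = (λ f → coeffwise (1*-coeff f)) , λ f → coeffwise λ n → ≡.trans (*-comm-coeff f 1# n) (1*-coeff f n) }
    ; comm = λ f g → coeffwise (*-comm-coeff f g) }

  *-distribʳ-≈ : ∀ h f g → (f + g) * h ≈ f * h + g * h
  *-distribʳ-≈ h f g = coeffwise (*-distribʳ-coeff h f g)

  *-distribˡ-≈ : ∀ h f g → h * (f + g) ≈ h * f + h * g
  *-distribˡ-≈ h f g = coeffwise λ n → ≡.trans (*-comm-coeff h (f + g) n)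
    (≡.trans (*-distribʳ-coeff h f g n) (cong₂ _xor_ (*-comm-coeff f h n) (*-comm-coeff g h n)))

  0*≈0 : ∀ f → 0# * f ≈ 0#
  0*≈0 f = coeffwise (0*-coeff f)

  *0≈0 : ∀ f → f * 0# ≈ 0#
  *0≈0 f = coeffwise λ n → ≡.trans (*-comm-coeff f 0# n) (0*-coeff f n)

  f+f≈0 : ∀ f → f + f ≈ 0#
  f+f≈0 f = coeffwise λ n → xor-same (f n)

𝔽₂⟦q⟧-commutativeSemiring : CommutativeSemiring 0ℓ 0ℓ
𝔽₂⟦q⟧-commutativeSemiring = record
  { Carrier = 𝔽₂⟦q⟧ ; _≈_ = _≈_ ; _+_ = _+_ ; _*_ = _*_ ; 0# = 0# ; 1# = 1#
  ; isCommutativeSemiring = record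
    { isSemiring = record
      { isSemiringWithoutAnnihilatingZero = record
        { +-isCommutativeMonoid = +-isCommutativeMonoid
        ; *-cong = *.∙-cong ; *-assoc = *.assoc ; *-identity = *.identity
        ; distrib = *-distribˡ-≈ , *-distribʳ-≈ }
      ; zero = 0*≈0 , *0≈0 }
    ; *-comm = *.comm } }
  where module * = IsCommutativeMonoid *-isCommutativeMonoid

open CommutativeSemiring 𝔽₂⟦q⟧-commutativeSemiring
  using (setoid; refl; sym; trans; +-cong; +-congˡ; +-congʳ; *-cong; *-congˡ; *-congʳ; *-comm; *-assoc; *-identityˡ; *-identityʳ;
         +-assoc; +-comm; +-identityˡ; +-identityʳ; distribˡ; distribʳ; zeroˡ; zeroʳ; reflexive)
open import Algebra.Properties.CommutativeSemiring.Exp 𝔽₂⟦q⟧-commutativeSemiring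
  using (_^_; ^-congˡ; ^-congʳ; ^-homo-*; ^-assocʳ; ^-distrib-*)

^-cong-[] : ∀ t {N f g} → f ≈[ N ] g → f ^ t ≈[ N ] g ^ t
^-cong-[] zero    f≈g = ≈⇒≈[] refl
^-cong-[] (suc t) f≈g = *-cong-[] f≈g (^-cong-[] t f≈g)

1^n≈1 : ∀ n → 1# ^ n ≈ 1#
1^n≈1 zero    = refl
1^n≈1 (suc n) = trans (*-identityˡ _) (1^n≈1 n)

inverse-^ : ∀ n {f g} → f * g ≈ 1# → f ^ n * g ^ n ≈ 1#
inverse-^ n {f} {g} fg≈1 = trans (sym (^-distrib-* f g n)) (trans (^-congˡ n fg≈1) (1^n≈1 n))

private
  𝔽₂-algebra : AlmostCommutativeRing 0ℓ 0ℓ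
  𝔽₂-algebra = fromCommutativeSemiring 𝔽₂⟦q⟧-commutativeSemiring

  𝔽₂ = CommutativeRing.rawRing xor-∧-commutativeRing

  scalar : Bool → 𝔽₂⟦q⟧
  scalar false = 0#
  scalar true  = 1#

  scalars : 𝔽₂ -Raw-AlmostCommutative⟶ 𝔽₂-algebra
  scalars = record
    { ⟦_⟧ = scalar
    ; +-homo = λ { false b → sym (+-identityˡ _) ; true false → sym (+-identityʳ _) ; true true → sym (f+f≈0 _) }
    ; *-homo = λ { false b → sym (zeroˡ _) ; true b → sym (*-identityˡ _) }
    ; -‿homo = λ { false → refl ; true → refl }
    ; 0-homo = refl
    ; 1-homo = refl }

  _scalar≟_ : WeaklyDecidable (λ b b′ → scalar b ≈ scalar b′)
  false scalar≟ false = just refl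
  true  scalar≟ true  = just refl
  false scalar≟ true  = nothing
  true  scalar≟ false = nothing

-- The coefficients of the solver are the field 𝔽₂, so that it knows that 1 + 1 = 0.
module 𝔽₂-Solver = RingSolver 𝔽₂ 𝔽₂-algebra scalars
  _scalar≟_

*-cong-q^ : ∀ {N f g} m → f ≈[ N ] g → q ^ m * f ≈[ m ℕ.+ N ] q ^ m * g
*-cong-q^ zero    p = *-cong-[] (≈⇒≈[] refl) p
*-cong-q^ {N} {f} {g} (suc m) p = ≈[]-trans (≈⇒≈[] (*-assoc q (q ^ m) f))
  (≈[]-trans (step (*-cong-q^ m p)) (≈⇒≈[] (sym (*-assoc q (q ^ m) g))))
  where
  step : ∀ {n f g} → f ≈[ n ] g → q * f ≈[ suc n ] q * g
  step p = coeffwise λ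
    { zero    _         → ≡.trans (q*-coeff₀ _) (≡.sym (q*-coeff₀ _))
    ; (suc k) (s≤s k<n) → ≡.trans (q*-coeff₊ _ k) (≡.trans (coeff-< p k k<n) (≡.sym (q*-coeff₊ _ k))) }

q^*-coeff : ∀ m f n → (q ^ m * f) (m ℕ.+ n) ≡ f n
q^*-coeff zero    f n = coeff (*-identityˡ f) n
q^*-coeff (suc m) f n = ≡.trans (coeff (*-assoc q (q ^ m) f) (suc m ℕ.+ n))
  (≡.trans (q*-coeff₊ _ (m ℕ.+ n)) (q^*-coeff m f n))

q^*-cancel : ∀ {N f g} m → q ^ m * f ≈[ m ℕ.+ N ] q ^ m * g → f ≈[ N ] g
q^*-cancel m p = coeffwise λ n n<N →
  ≡.trans (≡.sym (q^*-coeff m _ n)) (≡.trans (coeff-< p (m ℕ.+ n) (ℕₚ.+-monoʳ-< m n<N)) (q^*-coeff m _ n))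

q*-injective : ∀ {f g} → q * f ≈ q * g → f ≈ g
q*-injective p = coeffwise λ n → ≡.trans (≡.sym (q*-coeff₊ _ n)) (≡.trans (coeff p (suc n)) (q*-coeff₊ _ n))

q^*≈0 : ∀ m f → q ^ m * f ≈[ m ] 0#
q^*≈0 m f = ≈[]-weaken (ℕₚ.m≤m+n m 0)
  (≈[]-trans (*-cong-q^ {0} m (coeffwise λ _ ())) (≈⇒≈[] (zeroʳ (q ^ m))))

q^≈0 : ∀ m → q ^ m ≈[ m ] 0#
q^≈0 m = ≈[]-trans (≈⇒≈[] (sym (*-identityʳ (q ^ m)))) (q^*≈0 m 1#)

+≈0⇒≈-[] : ∀ {N f g} → f + g ≈[ N ] 0# → f ≈[ N ] g
+≈0⇒≈-[] {N} {f} {g} p = ≈[]-trans (≈⇒≈[] (solve 2 (λ f g → f := (f :+ g) :+ g) refl f g))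
  (≈[]-trans (+-cong-[] p (≈⇒≈[] refl)) (≈⇒≈[] (+-identityˡ g)))
  where open 𝔽₂-Solver

-- A series with constant term 1 is a unit, so no precision is lost. For u = g + h, the lowest
-- coefficient of f u forces u₀ = 0; then f (u / q) vanishes as well, and the argument repeats.
*-cancelˡ-[] : ∀ {N} f {g h} → f 0 ≡ true → f * g ≈[ N ] f * h → g ≈[ N ] h
*-cancelˡ-[] {N} f {g} {h} f₀ p = +≈0⇒≈-[] (coeffwise λ n n<N →
  ≡.trans (vanish (g + h) n (λ k k≤n → coeff-< f*[g+h]≈0 k (ℕₚ.≤-<-trans k≤n n<N))) (≡.sym (0#-coeff n)))
  where
  f*[g+h]≈0 : f * (g + h) ≈[ N ] 0#
  f*[g+h]≈0 = ≈[]-trans (≈⇒≈[] (distribˡ f g h)) (≈[]-trans (+-cong-[] p (≈⇒≈[] refl)) (≈⇒≈[] (f+f≈0 (f * h))))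

  vanish : ∀ u n → (∀ k → k ≤ n → (f * u) k ≡ 0# k) → u n ≡ false
  vanish u zero    z = ≡.trans (≡.trans (cong (_∧ u 0) (≡.sym f₀)) (≡.sym (*-coeff₀ f u))) (≡.trans (z 0 z≤n) (0#-coeff 0))
  vanish u (suc n) z = vanish (u ∘ suc) n λ k k≤n → begin
    (f * (u ∘ suc)) k                              ≡⟨ xor-identityʳ _ ⟨
    (f * (u ∘ suc)) k xor false                    ≡⟨ cong ((f * (u ∘ suc)) k xor_) (∧-zeroʳ (f (suc k))) ⟨
    (f * (u ∘ suc)) k xor (f (suc k) ∧ false)      ≡⟨ cong (λ b → (f * (u ∘ suc)) k xor (f (suc k) ∧ b)) (vanish u 0 λ j j≤0 → z j (ℕₚ.≤-trans j≤0 z≤n)) ⟨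
    (f * (u ∘ suc)) k xor (f (suc k) ∧ u 0)        ≡⟨ *-coeff₊′ f u k ⟨
    (f * u) (suc k)                                ≡⟨ z (suc k) (s≤s k≤n) ⟩
    0# (suc k)                                     ≡⟨ ≡.trans (0#-coeff (suc k)) (≡.sym (0#-coeff k)) ⟩
    0# k                                           ∎
    where open ≡-Reasoning

*-cancelˡ : ∀ f {g h} → f 0 ≡ true → f * g ≈ f * h → g ≈ h
*-cancelˡ f f₀ p = ≈[]⇒≈ λ N → *-cancelˡ-[] f f₀ (≈⇒≈[] p)

+≈0⇒≈ : ∀ {f g} → f + g ≈ 0# → f ≈ g
+≈0⇒≈ p = ≈[]⇒≈ λ N → +≈0⇒≈-[] (≈⇒≈[] p)

open SetoidReasoning setoid

-- Sections and the substitution q ↦ qᵈ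

sec : ℕ → ℕ → 𝔽₂⟦q⟧ → 𝔽₂⟦q⟧
sec d r f n = f (r ℕ.+ n ℕ.* d)

-- spread p c f = qᶜ f(qᵖ⁺¹)
spread : ℕ → ℕ → 𝔽₂⟦q⟧ → 𝔽₂⟦q⟧
spread p zero    f zero    = f 0
spread p zero    f (suc n) = spread p p (f ∘ suc) n
spread p (suc c) f zero    = false
spread p (suc c) f (suc n) = spread p c f n

-- The substitution q ↦ qᵈ for d ≥ 1. The counter of `spread` runs through the inserted zeros, so no
-- index has to be divided by d.
φ : ℕ → 𝔽₂⟦q⟧ → 𝔽₂⟦q⟧
φ d = spread (ℕ.pred d) 0

sec-cong : ∀ {f g} d r → f ≈ g → sec d r f ≈ sec d r g
sec-cong d r p = coeffwise λ n → coeff p (r ℕ.+ n ℕ.* d)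

sec-+ : ∀ d r f g → sec d r (f + g) ≈ sec d r f + sec d r g
sec-+ d r f g = coeffwise λ n → ≡.trans (+-coeff f g _) (≡.sym (+-coeff _ _ n))

sec-0 : ∀ d r → sec d r 0# ≈ 0#
sec-0 d r = coeffwise λ n → ≡.trans (0#-coeff (r ℕ.+ n ℕ.* d)) (≡.sym (0#-coeff n))

sec-suc-q* : ∀ d r f → sec d (suc r) (q * f) ≈ sec d r f
sec-suc-q* d r f = coeffwise λ n → q*-coeff₊ f _

sec-zero-q* : ∀ p f → sec (suc p) 0 (q * f) ≈ q * sec (suc p) p f
sec-zero-q* p f = coeffwise λ
  { zero    → ≡.trans (q*-coeff₀ f) (≡.sym (q*-coeff₀ _))
  ; (suc n) → ≡.trans (q*-coeff₊ f (p ℕ.+ n ℕ.* suc p)) (≡.sym (q*-coeff₊ _ n)) }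

swap : ∀ r d n → r ℕ.+ (d ℕ.+ n ℕ.* d) ≡ d ℕ.+ (r ℕ.+ n ℕ.* d)
swap r d n = solve 3 (λ r d m → r :+ (d :+ m) := d :+ (r :+ m)) ≡.refl r d (n ℕ.* d)
  where open Data.Nat.Solver.+-*-Solver

sec-q^* : ∀ p r f → r < suc p → sec (suc p) r (q ^ suc p * f) ≈ q * sec (suc p) r f
sec-q^* p r f r<d = coeffwise λ
  { zero    → ≡.trans (coeff-< (q^*≈0 (suc p) f) (r ℕ.+ 0) (≡.subst (_< suc p) (≡.sym (ℕₚ.+-identityʳ r)) r<d))
                      (≡.trans (0#-coeff (r ℕ.+ 0)) (≡.sym (q*-coeff₀ _)))
  ; (suc n) → ≡.trans (cong (q ^ suc p * f) (swap r (suc p) n)) (≡.trans (q^*-coeff (suc p) f (r ℕ.+ n ℕ.* suc p)) (≡.sym (q*-coeff₊ _ n))) }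

sec-ext : ∀ p {f g} → (∀ r → r < suc p → sec (suc p) r f ≈ sec (suc p) r g) → f ≈ g
sec-ext p {f} {g} h = coeffwise λ n → ≡.subst (λ m → f m ≡ g m) (≡.sym (m≡m%n+[m/n]*n n (suc p)))
  (coeff (h (n ℕ.% suc p) (m%n<n n (suc p))) (n ℕ./ suc p))

-- Sections are linear over series in qᵈ. The helpers follow the product recursion through one block
-- of d coefficients of `spread`: the leading one contributes, the p zeros do not, and the next
-- block is the same situation for a shifted f. With `sec-ext` this yields all the laws of `φ`.
sec-φ* : ∀ p r f g → r < suc p → sec (suc p) r (φ (suc p) f * g) ≈ f * sec (suc p) r g
sec-φ* p r f g r<d = coeffwise (at f)
  where
  below : ∀ c f n → n < c → (spread p c f * g) n ≡ false
  below (suc c) f zero    _         = *-coeff₀ _ g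
  below (suc c) f (suc n) (s≤s n<c) = ≡.trans (*-coeff₊ _ g n) (below c f n n<c)

  above : ∀ c f n → (spread p c f * g) (c ℕ.+ n) ≡ (spread p 0 f * g) n
  above zero    f n = ≡.refl
  above (suc c) f n = ≡.trans (*-coeff₊ _ g (c ℕ.+ n)) (above c f n)

  small : ∀ f n → n < suc p → (spread p 0 f * g) n ≡ f 0 ∧ g n
  small f zero    _         = *-coeff₀ _ g
  small f (suc n) (s≤s n<p) = ≡.trans (*-coeff₊ _ g n)
    (≡.trans (cong ((f 0 ∧ g (suc n)) xor_) (below p (f ∘ suc) n n<p)) (xor-identityʳ _))

  large : ∀ f n → (spread p 0 f * g) (suc p ℕ.+ n) ≡ (f 0 ∧ g (suc p ℕ.+ n)) xor (spread p 0 (f ∘ suc) * g) n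
  large f n = ≡.trans (*-coeff₊ _ g (p ℕ.+ n)) (cong ((f 0 ∧ g (suc (p ℕ.+ n))) xor_) (above p (f ∘ suc) n))

  at : ∀ f n → (spread p 0 f * g) (r ℕ.+ n ℕ.* suc p) ≡ (f * sec (suc p) r g) n
  at f zero    = ≡.trans (small f (r ℕ.+ 0) (≡.subst (_< suc p) (≡.sym (ℕₚ.+-identityʳ r)) r<d)) (≡.sym (*-coeff₀ f _))
  at f (suc n) = ≡.trans (cong (spread p 0 f * g) (swap r (suc p) n)) (≡.trans (large f (r ℕ.+ n ℕ.* suc p))
    (≡.trans (cong₂ _xor_ (cong (λ m → f 0 ∧ g m) (≡.sym (swap r (suc p) n))) (at (f ∘ suc) n)) (≡.sym (*-coeff₊ f _ n))))

sec₀-1 : ∀ p → sec (suc p) 0 1# ≈ 1#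
sec₀-1 p = coeffwise λ { zero → ≡.refl ; (suc n) → ≡.trans (1#-coeff₊ _) (≡.sym (1#-coeff₊ n)) }

sec₊-1 : ∀ d r → sec d (suc r) 1# ≈ 0#
sec₊-1 d r = coeffwise λ n → ≡.trans (1#-coeff₊ _) (≡.sym (0#-coeff n))

-- The default 0# allows a dissection to omit its trailing zero sections.
nth : List 𝔽₂⟦q⟧ → ℕ → 𝔽₂⟦q⟧
nth []       r       = 0#
nth (f ∷ fs) zero    = f
nth (f ∷ fs) (suc r) = nth fs r

module _ (p : ℕ) where
  private d = suc p

  sec-φ : ∀ r f → r < d → sec d r (φ d f) ≈ f * sec d r 1#
  sec-φ r f r<d = trans (sec-cong d r (sym (*-identityʳ (φ d f)))) (sec-φ* p r f 1# r<d)

  sec₀-φ : ∀ f → sec d 0 (φ d f) ≈ f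
  sec₀-φ f = trans (sec-φ 0 f (s≤s z≤n)) (trans (*-congˡ (sec₀-1 p)) (*-identityʳ f))

  sec₊-φ : ∀ r f → suc r < d → sec d (suc r) (φ d f) ≈ 0#
  sec₊-φ r f r<d = trans (sec-φ (suc r) f r<d) (trans (*-congˡ (sec₊-1 d r)) (zeroʳ f))

  φ-cong-[] : ∀ {N f g} → f ≈[ N ] g → φ d f ≈[ N ] φ d g
  φ-cong-[] {N} {f} {g} f≈g = coeffwise λ n n<N →
    ≡.subst (λ m → φ d f m ≡ φ d g m) (≡.sym (m≡m%n+[m/n]*n n d))
      (≡.trans (coeff (sec-φ (n ℕ.% d) f (m%n<n n d)) (n ℕ./ d))
      (≡.trans (coeff-< (*-cong-[] f≈g (≈⇒≈[] refl)) (n ℕ./ d) (ℕₚ.≤-<-trans (m/n≤m n d) n<N))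
      (≡.sym (coeff (sec-φ (n ℕ.% d) g (m%n<n n d)) (n ℕ./ d)))))

  φ-cong : ∀ {f g} → f ≈ g → φ d f ≈ φ d g
  φ-cong f≈g = ≈[]⇒≈ λ N → φ-cong-[] (≈⇒≈[] f≈g)

  φ-+ : ∀ f g → φ d (f + g) ≈ φ d f + φ d g
  φ-+ f g = sec-ext p λ r r<d → begin
    sec d r (φ d (f + g))               ≈⟨ sec-φ r (f + g) r<d ⟩
    (f + g) * sec d r 1#                ≈⟨ distribʳ _ f g ⟩
    f * sec d r 1# + g * sec d r 1#     ≈⟨ +-cong (sec-φ r f r<d) (sec-φ r g r<d) ⟨
    sec d r (φ d f) + sec d r (φ d g)   ≈⟨ sec-+ d r _ _ ⟨
    sec d r (φ d f + φ d g)             ∎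

  φ-* : ∀ f g → φ d (f * g) ≈ φ d f * φ d g
  φ-* f g = sec-ext p λ r r<d → begin
    sec d r (φ d (f * g))     ≈⟨ sec-φ r (f * g) r<d ⟩
    (f * g) * sec d r 1#      ≈⟨ *-assoc f g _ ⟩
    f * (g * sec d r 1#)      ≈⟨ *-congˡ (sec-φ r g r<d) ⟨
    f * sec d r (φ d g)       ≈⟨ sec-φ* p r f (φ d g) r<d ⟨
    sec d r (φ d f * φ d g)   ∎

  φ-1 : φ d 1# ≈ 1#
  φ-1 = sec-ext p λ r r<d → trans (sec-φ r 1# r<d) (*-identityˡ _)

  φ-0 : φ d 0# ≈ 0#
  φ-0 = sec-ext p λ r r<d → trans (sec-φ r 0# r<d) (trans (zeroˡ _) (sym (sec-0 d r)))

  φ-q : φ d q ≈ q ^ d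
  φ-q = sec-ext p λ r r<d → trans (sec-φ r q r<d) (sym (trans (sec-cong d r (sym (*-identityʳ (q ^ d)))) (sec-q^* p r 1# r<d)))

  φ-^ : ∀ f n → φ d (f ^ n) ≈ φ d f ^ n
  φ-^ f zero    = φ-1
  φ-^ f (suc n) = trans (φ-* f (f ^ n)) (*-congˡ (φ-^ f n))

  φ-q^ : ∀ n → φ d (q ^ n) ≈ q ^ (d ℕ.* n)
  φ-q^ n = trans (φ-^ q n) (trans (^-congˡ n φ-q) (^-assocʳ q d n))

  -- A ring endomorphism commutes with polynomial expressions. Induction on the syntax of the solver
  -- lets long expressions be transported in one step.
  φ-polynomial : ∀ {n} (P : 𝔽₂-Solver.Polynomial n) ρ ρ′ → (∀ i → φ d (lookup ρ i) ≈ lookup ρ′ i) →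
                 φ d (𝔽₂-Solver.⟦ P ⟧ ρ) ≈ 𝔽₂-Solver.⟦ P ⟧ ρ′
  φ-polynomial (𝔽₂-Solver.op 𝔽₂-Solver.[+] P R) ρ ρ′ h = trans (φ-+ _ _) (+-cong (φ-polynomial P ρ ρ′ h) (φ-polynomial R ρ ρ′ h))
  φ-polynomial (𝔽₂-Solver.op 𝔽₂-Solver.[*] P R) ρ ρ′ h = trans (φ-* _ _) (*-cong (φ-polynomial P ρ ρ′ h) (φ-polynomial R ρ ρ′ h))
  φ-polynomial (𝔽₂-Solver.con false) ρ ρ′ h = φ-0
  φ-polynomial (𝔽₂-Solver.con true)  ρ ρ′ h = φ-1
  φ-polynomial (𝔽₂-Solver.var i)     ρ ρ′ h = h i
  φ-polynomial (P 𝔽₂-Solver.:^ n)    ρ ρ′ h = trans (φ-^ _ n) (^-congˡ n (φ-polynomial P ρ ρ′ h))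
  φ-polynomial (𝔽₂-Solver.:- P)      ρ ρ′ h = φ-polynomial P ρ ρ′ h

  -- The series ∑ qʳ fᵣ(qᵈ) in Horner form: the inverse of taking sections.
  interleave : List 𝔽₂⟦q⟧ → 𝔽₂⟦q⟧
  interleave []       = 0#
  interleave (f ∷ fs) = φ d f + q * interleave fs

  sec-interleave : ∀ fs r → length fs ≤ d → r < d → sec d r (interleave fs) ≈ nth fs r
  sec-interleave []       r       _    _   = sec-0 d r
  sec-interleave (f ∷ fs) zero    (s≤s len≤p) _   = begin
    sec d 0 (φ d f + q * interleave fs)            ≈⟨ sec-+ d 0 _ _ ⟩
    sec d 0 (φ d f) + sec d 0 (q * interleave fs)  ≈⟨ +-cong (sec₀-φ f) (sec-zero-q* p _) ⟩
    -- Class 0 of q times the rest is class p of the rest. At most p entries remain, so this class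
    -- is zero and residues do not wrap round.
    f + q * sec d p (interleave fs)                ≈⟨ +-congˡ (*-congˡ (trans (sec-interleave fs p (ℕₚ.m≤n⇒m≤1+n len≤p) ℕₚ.≤-refl) (nth-beyond fs p len≤p))) ⟩
    f + q * 0#                                     ≈⟨ +-congˡ (zeroʳ q) ⟩
    f + 0#                                         ≈⟨ +-identityʳ f ⟩
    f                                              ∎
    where
    nth-beyond : ∀ fs r → length fs ≤ r → nth fs r ≈ 0#
    nth-beyond []       r       _       = refl
    nth-beyond (f ∷ fs) (suc r) (s≤s l) = nth-beyond fs r l
  sec-interleave (f ∷ fs) (suc r) (s≤s len≤p) (s≤s r<p) = begin
    sec d (suc r) (φ d f + q * interleave fs)                 ≈⟨ sec-+ d (suc r) _ _ ⟩
    sec d (suc r) (φ d f) + sec d (suc r) (q * interleave fs) ≈⟨ +-cong (sec₊-φ r f (s≤s r<p)) (sec-suc-q* d r _) ⟩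
    0# + sec d r (interleave fs)                              ≈⟨ +-identityˡ _ ⟩
    sec d r (interleave fs)                                   ≈⟨ sec-interleave fs r (ℕₚ.m≤n⇒m≤1+n len≤p) (ℕₚ.m≤n⇒m≤1+n r<p) ⟩
    nth fs r                                                  ∎

  -- The lowest exponent n of f would satisfy n = 1 + d n.
  fixed-point-free : ∀ {f} → f ≈ q * φ d f → f ≈ 0#
  fixed-point-free {f} f≈qφf = ≈[]⇒≈ vanish
    where
    vanish : ∀ N → f ≈[ N ] 0#
    vanish zero    = coeffwise λ _ ()
    vanish (suc N) = ≈[]-trans (≈⇒≈[] f≈qφf) (≈[]-trans (≈⇒≈[] (*-congʳ (sym (*-identityʳ q))))
      (≈[]-trans (*-cong-q^ 1 (φ-cong-[] (vanish N)))
        (≈⇒≈[] (trans (*-congˡ φ-0) (zeroʳ _)))))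

-- Infinite sums and products

-- Infinite sums and infinite products are treated together: both come from a commutative monoid
-- whose operation respects congruence modulo qᴺ.
module Folds {_∙_ : 𝔽₂⟦q⟧ → 𝔽₂⟦q⟧ → 𝔽₂⟦q⟧} {ε : 𝔽₂⟦q⟧} (isCommutativeMonoid : IsCommutativeMonoid _≈_ _∙_ ε)
  (∙-cong-[] : ∀ {N f f′ g g′} → f ≈[ N ] f′ → g ≈[ N ] g′ → (f ∙ g) ≈[ N ] (f′ ∙ g′)) where

  open IsCommutativeMonoid isCommutativeMonoid using (∙-cong; assoc; comm; identityˡ)

  fold : (ℕ → 𝔽₂⟦q⟧) → ℕ → 𝔽₂⟦q⟧
  fold t zero    = ε
  fold t (suc N) = t N ∙ fold t N

  -- Coefficient n is read off from the first n + 1 terms; under `Convergent` all later ones are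
  -- trivial modulo qⁿ⁺¹.
  inf : (ℕ → 𝔽₂⟦q⟧) → 𝔽₂⟦q⟧
  inf t n = fold t (suc n) n

  Convergent : (ℕ → 𝔽₂⟦q⟧) → Set
  Convergent t = ∀ n → t n ≈[ n ] ε

  interchange : ∀ a b c e → (a ∙ b) ∙ (c ∙ e) ≈ (a ∙ c) ∙ (b ∙ e)
  interchange a b c e = begin
    (a ∙ b) ∙ (c ∙ e) ≈⟨ assoc a b _ ⟩
    a ∙ (b ∙ (c ∙ e)) ≈⟨ ∙-cong refl (assoc b c e) ⟨
    a ∙ ((b ∙ c) ∙ e) ≈⟨ ∙-cong refl (∙-cong (comm b c) refl) ⟩
    a ∙ ((c ∙ b) ∙ e) ≈⟨ ∙-cong refl (assoc c b e) ⟩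
    a ∙ (c ∙ (b ∙ e)) ≈⟨ assoc a c _ ⟨
    (a ∙ c) ∙ (b ∙ e) ∎

  fold-cong-[] : ∀ {M t u} → (∀ n → t n ≈[ M ] u n) → ∀ N → fold t N ≈[ M ] fold u N
  fold-cong-[] t≈u zero    = ≈⇒≈[] refl
  fold-cong-[] t≈u (suc N) = ∙-cong-[] (t≈u N) (fold-cong-[] t≈u N)

  fold-cong : ∀ {t u} → (∀ n → t n ≈ u n) → ∀ N → fold t N ≈ fold u N
  fold-cong t≈u N = ≈[]⇒≈ λ M → fold-cong-[] (λ n → ≈⇒≈[] (t≈u n)) N

  fold-ε : ∀ N → fold (λ _ → ε) N ≈ ε
  fold-ε zero    = refl
  fold-ε (suc N) = trans (identityˡ _) (fold-ε N)

  fold-∙ : ∀ t u N → fold (λ n → t n ∙ u n) N ≈ fold t N ∙ fold u N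
  fold-∙ t u zero    = sym (identityˡ ε)
  fold-∙ t u (suc N) = trans (∙-cong refl (fold-∙ t u N)) (interchange _ _ _ _)

  fold-+ : ∀ t m n → fold t (m ℕ.+ n) ≈ fold (λ k → t (k ℕ.+ n)) m ∙ fold t n
  fold-+ t zero    n = sym (identityˡ _)
  fold-+ t (suc m) n = trans (∙-cong refl (fold-+ t m n)) (sym (assoc _ _ _))

  fold-first : ∀ t N → fold t (suc N) ≈ t 0 ∙ fold (t ∘ suc) N
  fold-first t zero    = refl
  fold-first t (suc N) = begin
    t (suc N) ∙ fold t (suc N)               ≈⟨ ∙-cong refl (fold-first t N) ⟩
    t (suc N) ∙ (t 0 ∙ fold (t ∘ suc) N)     ≈⟨ assoc _ _ _ ⟨
    (t (suc N) ∙ t 0) ∙ fold (t ∘ suc) N     ≈⟨ ∙-cong (comm _ _) refl ⟩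
    (t 0 ∙ t (suc N)) ∙ fold (t ∘ suc) N     ≈⟨ assoc _ _ _ ⟩
    t 0 ∙ fold (t ∘ suc) (suc N)             ∎

  fold-transpose : ∀ (t : ℕ → ℕ → 𝔽₂⟦q⟧) d N → fold (λ n → fold (λ r → t r n) d) N ≈ fold (λ r → fold (t r) N) d
  fold-transpose t d zero    = sym (fold-ε d)
  fold-transpose t d (suc N) = trans (∙-cong refl (fold-transpose t d N)) (sym (fold-∙ (λ r → t r N) (λ r → fold (t r) N) d))

  fold-blocks : ∀ t d N → fold t (N ℕ.* d) ≈ fold (λ r → fold (λ n → t (r ℕ.+ n ℕ.* d)) N) d
  fold-blocks t d N = trans (rows N) (fold-transpose (λ r n → t (r ℕ.+ n ℕ.* d)) d N)
    where
    rows : ∀ N → fold t (N ℕ.* d) ≈ fold (λ n → fold (λ r → t (r ℕ.+ n ℕ.* d)) d) N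
    rows zero    = refl
    rows (suc N) = trans (fold-+ t d (N ℕ.* d)) (∙-cong refl (rows N))

  fold-stable : ∀ {t} → Convergent t → ∀ N m → fold t (m ℕ.+ N) ≈[ N ] fold t N
  fold-stable c N zero    = ≈⇒≈[] refl
  fold-stable c N (suc m) = ≈[]-trans
    (∙-cong-[] (≈[]-weaken (ℕₚ.m≤n+m N m) (c (m ℕ.+ N))) (fold-stable c N m)) (≈⇒≈[] (identityˡ _))

  inf≈fold : ∀ {t} → Convergent t → ∀ N → inf t ≈[ N ] fold t N
  inf≈fold {t} c N = coeffwise λ n n<N → ≡.trans
    (≡.sym (coeff-< (fold-stable c (suc n) (N ℕ.∸ suc n)) n ℕₚ.≤-refl))
    (cong (λ m → fold t m n) (ℕₚ.m∸n+n≡m n<N))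

  inf-cong : ∀ {t u} → (∀ n → t n ≈ u n) → inf t ≈ inf u
  inf-cong t≈u = coeffwise λ n → coeff (fold-cong t≈u (suc n)) n

  inf-ε : inf (λ _ → ε) ≈ ε
  inf-ε = coeffwise λ n → coeff (fold-ε (suc n)) n

  inf-∙ : ∀ {t u} → Convergent t → Convergent u → inf (λ n → t n ∙ u n) ≈ inf t ∙ inf u
  inf-∙ {t} {u} ct cu = ≈[]⇒≈ λ N →
    ≈[]-trans (inf≈fold (λ n → ≈[]-trans (∙-cong-[] (ct n) (cu n)) (≈⇒≈[] (identityˡ ε))) N)
    (≈[]-trans (≈⇒≈[] (fold-∙ t u N)) (≈[]-sym (∙-cong-[] (inf≈fold ct N) (inf≈fold cu N))))

  inf-first : ∀ {t} → Convergent t → inf t ≈ t 0 ∙ inf (t ∘ suc)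
  inf-first {t} c = ≈[]⇒≈ λ N →
    ≈[]-trans (≈[]-weaken (ℕₚ.n≤1+n N) (inf≈fold c (suc N)))
    (≈[]-trans (≈⇒≈[] (fold-first t N))
      (∙-cong-[] (≈⇒≈[] refl) (≈[]-sym (inf≈fold (λ n → ≈[]-weaken (ℕₚ.n≤1+n n) (c (suc n))) N))))

  -- The infinite rearrangement by residue classes is finite modulo qᴺ: N (p+1) terms on the left, N
  -- in each class on the right.
  inf-blocks : ∀ {t} p → Convergent t → inf t ≈ fold (λ r → inf (λ n → t (r ℕ.+ n ℕ.* suc p))) (suc p)
  inf-blocks {t} p c = ≈[]⇒≈ λ N →
    ≈[]-trans (≈[]-weaken (ℕₚ.m≤m*n N (suc p)) (inf≈fold c (N ℕ.* suc p)))
    (≈[]-trans (≈⇒≈[] (fold-blocks t (suc p) N))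
      (fold-cong-[] (λ r → ≈[]-sym (inf≈fold (λ n → ≈[]-weaken (ℕₚ.≤-trans (ℕₚ.m≤m*n n (suc p)) (ℕₚ.m≤n+m _ r)) (c (r ℕ.+ n ℕ.* suc p))) N)) (suc p)))

  -- Respecting ≈[ N ] is q-adic continuity, which lets ψ pass through the limit. It serves for `φ`,
  -- for multiplication by a power of q and for t-th powers.
  inf-homomorphic : ∀ {t} (ψ : 𝔽₂⟦q⟧ → 𝔽₂⟦q⟧) → (∀ {N f g} → f ≈[ N ] g → ψ f ≈[ N ] ψ g) → ψ ε ≈ ε → (∀ f g → ψ (f ∙ g) ≈ ψ f ∙ ψ g) →
            Convergent t → ψ (inf t) ≈ inf (λ n → ψ (t n))
  inf-homomorphic {t} ψ ψ-cong-[] ψ-ε ψ-∙ c = ≈[]⇒≈ λ N →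
    ≈[]-trans (ψ-cong-[] (inf≈fold c N)) (≈[]-trans (≈⇒≈[] (finite N))
      (≈[]-sym (inf≈fold (λ n → ≈[]-trans (ψ-cong-[] (c n)) (≈⇒≈[] ψ-ε)) N)))
    where
    finite : ∀ N → ψ (fold t N) ≈ fold (λ n → ψ (t n)) N
    finite zero    = ψ-ε
    finite (suc N) = trans (ψ-∙ _ _) (∙-cong refl (finite N))

module ∑ = Folds +-isCommutativeMonoid +-cong-[]
module ∏ = Folds *-isCommutativeMonoid *-cong-[]

-- Theta series and the Jacobi triple product

tri : ℕ → ℕ
tri zero    = 0
tri (suc n) = tri n ℕ.+ n

tri-+ : ∀ m n → tri (m ℕ.+ n) ≡ tri m ℕ.+ tri n ℕ.+ m ℕ.* n
tri-+ zero    n = ≡.sym (ℕₚ.+-identityʳ _)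
tri-+ (suc m) n = ≡.trans (cong (ℕ._+ (m ℕ.+ n)) (tri-+ m n))
  (solve 5 (λ m n s t u → s :+ t :+ u :+ (m :+ n) := s :+ m :+ t :+ (n :+ u)) ≡.refl m n (tri m) (tri n) (m ℕ.* n))
  where open Data.Nat.Solver.+-*-Solver

n*n≡2tri+n : ∀ n → n ℕ.* n ≡ tri n ℕ.+ tri n ℕ.+ n
n*n≡2tri+n zero    = ≡.refl
n*n≡2tri+n (suc n) = ≡.trans
  (solve 1 (λ n → con 1 :+ (n :+ n :* (con 1 :+ n)) := con 1 :+ (n :+ (n :+ n :* n))) ≡.refl n)
  (≡.trans (cong (λ m → 1 ℕ.+ (n ℕ.+ (n ℕ.+ m))) (n*n≡2tri+n n))
    (solve 2 (λ n t → con 1 :+ (n :+ (n :+ (t :+ t :+ n))) := (t :+ n) :+ (t :+ n) :+ (con 1 :+ n)) ≡.refl n (tri n)))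
  where open Data.Nat.Solver.+-*-Solver

-- With tri j = j(j-1)/2, the sum of q^(M tri j + a j) over all j ∈ ℤ is 1 + H M a + H M (M - a):
-- the negative j give the second half, and j = 0 is counted twice.
thetaTerm : ℕ → ℕ → ℕ → 𝔽₂⟦q⟧
thetaTerm α β j = q ^ (α ℕ.* tri j ℕ.+ β ℕ.* j)

H : ℕ → ℕ → 𝔽₂⟦q⟧
H α β = ∑.inf (thetaTerm α β)

factor : ℕ → ℕ → ℕ → 𝔽₂⟦q⟧
factor M s n = 1# + q ^ (s ℕ.+ n ℕ.* M)

P : ℕ → ℕ → 𝔽₂⟦q⟧
P M s = ∏.inf (factor M s)

thetaTerm-convergent : ∀ α β .{{_ : NonZero β}} → ∑.Convergent (thetaTerm α β)
thetaTerm-convergent α β j = ≈[]-weaken (ℕₚ.≤-trans (ℕₚ.m≤n*m j β) (ℕₚ.m≤n+m _ (α ℕ.* tri j))) (q^≈0 _)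

1+q^≈1 : ∀ m → 1# + q ^ m ≈[ m ] 1#
1+q^≈1 m = ≈[]-trans (+-cong-[] (≈⇒≈[] refl) (q^≈0 m)) (≈⇒≈[] (+-identityʳ 1#))

factor-convergent : ∀ M s .{{_ : NonZero M}} → ∏.Convergent (factor M s)
factor-convergent M s n = ≈[]-weaken (ℕₚ.≤-trans (ℕₚ.m≤m*n n M) (ℕₚ.m≤n+m _ s)) (1+q^≈1 _)

P-unit : ∀ M s .{{_ : NonZero s}} → P M s 0 ≡ true
P-unit M s = ≡.trans (coeff (*-identityʳ (factor M s 0)) 0)
  (≡.trans (coeff-< (1+q^≈1 (s ℕ.+ 0)) 0 (ℕₚ.≤-trans (ℕ.>-nonZero⁻¹ s) (ℕₚ.m≤m+n s 0))) 1#-coeff₀)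

-- Gaussian binomials and the finite form of the triple product

-- The antidiagonal sum over i + k = m. Two complementary indices avoid subtraction and suit
-- binomial coefficients.
asum : (ℕ → ℕ → 𝔽₂⟦q⟧) → ℕ → 𝔽₂⟦q⟧
asum t zero    = t 0 0
asum t (suc m) = t 0 (suc m) + asum (λ i k → t (suc i) k) m

asum-last : ∀ t m → asum t (suc m) ≈ asum (λ i k → t i (suc k)) m + t (suc m) 0
asum-last t zero    = refl
asum-last t (suc m) = trans (+-congˡ (asum-last (λ i k → t (suc i) k) m)) (sym (+-assoc _ _ _))

asum-cong-[] : ∀ {N t u} m → (∀ i k → i ℕ.+ k ≡ m → t i k ≈[ N ] u i k) → asum t m ≈[ N ] asum u m
asum-cong-[] zero    h = h 0 0 ≡.refl
asum-cong-[] (suc m) h = +-cong-[] (h 0 (suc m) ≡.refl) (asum-cong-[] m λ i k e → h (suc i) k (cong suc e))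

asum-cong : ∀ {t u} m → (∀ i k → i ℕ.+ k ≡ m → t i k ≈ u i k) → asum t m ≈ asum u m
asum-cong m h = ≈[]⇒≈ λ N → asum-cong-[] m λ i k e → ≈⇒≈[] (h i k e)

asum-+ : ∀ t u m → asum (λ i k → t i k + u i k) m ≈ asum t m + asum u m
asum-+ t u zero    = refl
asum-+ t u (suc m) = trans (+-congˡ (asum-+ _ _ m)) (∑.interchange _ _ _ _)

asum-* : ∀ c t m → asum (λ i k → c * t i k) m ≈ c * asum t m
asum-* c t zero    = refl
asum-* c t (suc m) = trans (+-congˡ (asum-* c _ m)) (sym (distribˡ c _ _))

-- A cut after i = n. In the triple product n + 1 is the middle of the expansion, and the pieces
-- become the two halves of the theta series.
asum-split : ∀ t n m → asum t (suc n ℕ.+ m) ≈ asum (λ i k → t i (suc k ℕ.+ m)) n + asum (λ i k → t (suc n ℕ.+ i) k) m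
asum-split t zero    m = refl
asum-split t (suc n) m = trans (+-congˡ (asum-split (λ i k → t (suc i) k) n m)) (sym (+-assoc _ _ _))

asum-first-index : ∀ t m → asum (λ i k → t i) m ≈ ∑.fold t (suc m)
asum-first-index t zero    = sym (+-identityʳ _)
asum-first-index t (suc m) = trans (asum-last (λ i k → t i) m) (trans (+-comm _ _) (+-congˡ (asum-first-index t m)))

asum-second-index : ∀ t m → asum (λ i k → t k) m ≈ ∑.fold t (suc m)
asum-second-index t zero    = sym (+-identityʳ _)
asum-second-index t (suc m) = +-congˡ (asum-second-index t m)

module GaussBinomial (Q : 𝔽₂⟦q⟧) where

  poch : ℕ → 𝔽₂⟦q⟧
  poch = ∏.fold (λ k → 1# + Q ^ suc k)

  -- gauss i k is the q-binomial coefficient [i + k choose i] in base Q.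
  gauss : ℕ → ℕ → 𝔽₂⟦q⟧
  gauss zero    k       = 1#
  gauss (suc i) zero    = 1#
  gauss (suc i) (suc k) = gauss i (suc k) + Q ^ suc i * gauss (suc i) k

  gauss-0ʳ : ∀ i → gauss i 0 ≡ 1#
  gauss-0ʳ zero    = ≡.refl
  gauss-0ʳ (suc i) = ≡.refl

  -- The quotient formula for Gaussian binomials, cleared of denominators. Pascal's rule reduces it
  -- to (1 + u) + u (1 + v) = 1 + uv in characteristic 2, with u = Qⁱ⁺¹ and v = Qᵏ⁺¹.
  poch-gauss : ∀ i k → poch i * poch k * gauss i k ≈ poch (i ℕ.+ k)
  poch-gauss zero    k    = trans (*-identityʳ _) (*-identityˡ _)
  poch-gauss (suc i) zero = trans (*-identityʳ _) (trans (*-identityʳ _) (reflexive (cong poch (≡.sym (ℕₚ.+-identityʳ (suc i))))))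
  poch-gauss (suc i) (suc k) = begin
    (1# + u) * poch i * ((1# + v) * poch k) * (g₁ + u * g₂)
      ≈⟨ solve 6 (λ u v a b g h → (con true :+ u) :* a :* ((con true :+ v) :* b) :* (g :+ u :* h)
                   := (con true :+ u) :* (a :* ((con true :+ v) :* b) :* g) :+ u :* (con true :+ v) :* ((con true :+ u) :* a :* b :* h))
               refl u v (poch i) (poch k) g₁ g₂ ⟩
    (1# + u) * (poch i * poch (suc k) * g₁) + u * (1# + v) * (poch (suc i) * poch k * g₂)
      ≈⟨ +-cong (*-congˡ (poch-gauss i (suc k)))
                (*-congˡ (trans (poch-gauss (suc i) k) (reflexive (cong poch (≡.sym (ℕₚ.+-suc i k)))))) ⟩
    (1# + u) * W + u * (1# + v) * W
      ≈⟨ solve 3 (λ u v w → (con true :+ u) :* w :+ u :* (con true :+ v) :* w := (con true :+ u :* v) :* w) refl u v W ⟩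
    (1# + u * v) * W
      ≈⟨ *-congʳ (+-congˡ (^-homo-* Q (suc i) (suc k))) ⟨
    (1# + Q ^ (suc i ℕ.+ suc k)) * W ∎
    where
    open 𝔽₂-Solver
    u v g₁ g₂ W : 𝔽₂⟦q⟧
    u = Q ^ suc i
    v = Q ^ suc k
    g₁ = gauss i (suc k)
    g₂ = gauss (suc i) k
    W = poch (i ℕ.+ suc k)

  term : 𝔽₂⟦q⟧ → 𝔽₂⟦q⟧ → ℕ → ℕ → 𝔽₂⟦q⟧
  term x y i k = Q ^ tri i * x ^ i * y ^ k * gauss i k

  -- Homogeneous in x and y, because y = Qᴺ in the application replaces the negative exponents of 1
  -- + z Qⁱ⁻ᴺ. Splitting off the factor i = 0 leaves the product for x Q.
  q-binomial-theorem : ∀ x y m → ∏.fold (λ i → y + x * Q ^ i) m ≈ asum (term x y) m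
  q-binomial-theorem x y zero    = solve 0 (con true := con true :* con true :* con true :* con true) refl
    where open 𝔽₂-Solver
  q-binomial-theorem x y (suc m) = begin
    ∏.fold (λ i → y + x * Q ^ i) (suc m)
      ≈⟨ ∏.fold-first (λ i → y + x * Q ^ i) m ⟩
    (y + x * 1#) * ∏.fold (λ i → y + x * Q ^ suc i) m
      ≈⟨ *-congˡ (∏.fold-cong (λ i → +-congˡ (sym (*-assoc x Q (Q ^ i)))) m) ⟩
    (y + x * 1#) * ∏.fold (λ i → y + x * Q * Q ^ i) m
      ≈⟨ *-congˡ (q-binomial-theorem (x * Q) y m) ⟩
    (y + x * 1#) * asum T′ m
      ≈⟨ solve 3 (λ x y a → (y :+ x :* con true) :* a := (con false :+ x :* a) :+ (y :* a :+ con false)) refl x y (asum T′ m) ⟩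
    (0# + x * asum T′ m) + (y * asum T′ m + 0#)
      ≈⟨ +-cong (+-congˡ (asum-* x T′ m)) (trans (asum-last V m) (+-congʳ (asum-* y T′ m))) ⟨
    asum U (suc m) + asum V (suc m)
      ≈⟨ asum-+ U V (suc m) ⟨
    asum (λ i k → U i k + V i k) (suc m)
      ≈⟨ asum-cong (suc m) pascal ⟨
    asum (term x y) (suc m) ∎
    where
    open 𝔽₂-Solver
    T′ U V : ℕ → ℕ → 𝔽₂⟦q⟧
    T′ = term (x * Q) y
    -- The factor x raises the first index and y the second, so each shifted array has a zero
    -- border.
    U zero    k = 0#
    U (suc i) k = x * T′ i k
    V i zero    = 0#
    V i (suc k) = y * T′ i k

    pascal : ∀ i k → i ℕ.+ k ≡ suc m → term x y i k ≈ U i k + V i k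
    pascal zero    (suc k) _ = solve 2 (λ y z → con true :* con true :* (y :* z) :* con true := con false :+ y :* (con true :* con true :* z :* con true)) refl y (y ^ k)
    pascal (suc i) zero    _ = begin
      Q ^ (tri i ℕ.+ i) * (x * x ^ i) * 1# * 1#        ≈⟨ *-congʳ (*-congʳ (*-congʳ (^-homo-* Q (tri i) i))) ⟩
      Q ^ tri i * Q ^ i * (x * x ^ i) * 1# * 1#        ≈⟨ solve 4 (λ t r x z → t :* r :* (x :* z) :* con true :* con true := x :* (t :* (z :* r) :* con true :* con true) :+ con false) refl (Q ^ tri i) (Q ^ i) x (x ^ i) ⟩
      x * (Q ^ tri i * (x ^ i * Q ^ i) * 1# * 1#) + 0# ≈⟨ +-congʳ (*-congˡ (*-cong (*-congʳ (*-congˡ (^-distrib-* x Q i))) (reflexive (gauss-0ʳ i)))) ⟨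
      x * (Q ^ tri i * (x * Q) ^ i * 1# * gauss i 0) + 0# ∎
    pascal (suc i) (suc k) _ = begin
      Q ^ (tri i ℕ.+ i) * (x * x ^ i) * (y * y ^ k) * (g₁ + Q * Q ^ i * g₂)
        ≈⟨ *-congʳ (*-congʳ (*-congʳ (^-homo-* Q (tri i) i))) ⟩
      Q ^ tri i * Q ^ i * (x * x ^ i) * (y * y ^ k) * (g₁ + Q * Q ^ i * g₂)
        ≈⟨ solve 9 (λ t r x z y w g h Q → t :* r :* (x :* z) :* (y :* w) :* (g :+ Q :* r :* h)
              := x :* (t :* (z :* r) :* (y :* w) :* g) :+ y :* (t :* r :* (x :* Q :* (z :* r)) :* w :* h))
              refl (Q ^ tri i) (Q ^ i) x (x ^ i) y (y ^ k) g₁ g₂ Q ⟩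
      x * (Q ^ tri i * (x ^ i * Q ^ i) * (y * y ^ k) * g₁) + y * (Q ^ tri i * Q ^ i * (x * Q * (x ^ i * Q ^ i)) * y ^ k * g₂)
        ≈⟨ +-cong (*-congˡ (*-congʳ (*-congʳ (*-congˡ (^-distrib-* x Q i)))))
                  (*-congˡ (*-congʳ (*-congʳ (*-cong (^-homo-* Q (tri i) i) (*-congˡ (^-distrib-* x Q i)))))) ⟨
      x * T′ i (suc k) + y * T′ (suc i) k ∎
      where
      g₁ g₂ : 𝔽₂⟦q⟧
      g₁ = gauss i (suc k)
      g₂ = gauss (suc i) k

-- Jacobi's identity in base Q = qᵃ⁺ᵇ at z = qᵃ. As z c = Q, the series c = qᵇ stands for Q / z, and
-- every exponent stays nonnegative.
module TripleProduct (a b : ℕ) .{{_ : NonZero a}} .{{_ : NonZero b}} where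

  private
    M : ℕ
    M = a ℕ.+ b

    instance
      M≢0 : NonZero M
      M≢0 = ℕ.>-nonZero (ℕₚ.≤-trans (ℕ.>-nonZero⁻¹ a) (ℕₚ.m≤m+n a b))

    Q z c : 𝔽₂⟦q⟧
    Q = q ^ M
    z = q ^ a
    c = q ^ b

  open GaussBinomial Q

  private
    zc≈Q : z * c ≈ Q
    zc≈Q = sym (^-homo-* q a b)

    q^[s+n*M] : ∀ s n → q ^ (s ℕ.+ n ℕ.* M) ≈ q ^ s * Q ^ n
    q^[s+n*M] s n = trans (^-homo-* q s (n ℕ.* M)) (*-congˡ (trans (^-congʳ q (ℕₚ.*-comm n M)) (sym (^-assocʳ q M n))))

    thetaTerm≈ : ∀ s j → thetaTerm M s j ≈ Q ^ tri j * (q ^ s) ^ j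
    thetaTerm≈ s j = trans (^-homo-* q (M ℕ.* tri j) (s ℕ.* j)) (sym (*-cong (^-assocʳ q M (tri j)) (^-assocʳ q s j)))

    lo hi : ℕ → 𝔽₂⟦q⟧
    lo = ∏.fold (λ k → 1# + z * Q ^ k)
    hi = ∏.fold (λ k → 1# + c * Q ^ k)

    -- Factor i equals z Qⁱ (1 + c Qⁿ⁻¹⁻ⁱ), because z c = Q.
    lower-half : ∀ n → ∏.fold (λ i → Q ^ n + z * Q ^ i) n ≈ Q ^ tri n * z ^ n * hi n
    lower-half zero    = solve 0 (con true := con true :* con true :* con true) refl
      where open 𝔽₂-Solver
    lower-half (suc n) = begin
      ∏.fold (λ i → Q ^ suc n + z * Q ^ i) (suc n)
        ≈⟨ ∏.fold-first (λ i → Q ^ suc n + z * Q ^ i) n ⟩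
      (Q * Q ^ n + z * 1#) * ∏.fold (λ i → Q * Q ^ n + z * (Q * Q ^ i)) n
        ≈⟨ *-cong (+-congʳ (*-congʳ (sym zc≈Q)))
             (∏.fold-cong (λ i → solve 4 (λ Q u z v → Q :* u :+ z :* (Q :* v) := Q :* (u :+ z :* v)) refl Q (Q ^ n) z (Q ^ i)) n) ⟩
      (z * c * Q ^ n + z * 1#) * ∏.fold (λ i → Q * (Q ^ n + z * Q ^ i)) n
        ≈⟨ *-congˡ (trans (∏.fold-∙ (λ _ → Q) (λ i → Q ^ n + z * Q ^ i) n) (*-cong (fold-const Q n) (lower-half n))) ⟩
      (z * c * Q ^ n + z * 1#) * (Q ^ n * (Q ^ tri n * z ^ n * hi n))
        ≈⟨ solve 6 (λ z c u t v h → (z :* c :* u :+ z :* con true) :* (u :* (t :* v :* h))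
                                  := t :* u :* (z :* v) :* ((con true :+ c :* u) :* h)) refl z c (Q ^ n) (Q ^ tri n) (z ^ n) (hi n) ⟩
      Q ^ tri n * Q ^ n * (z * z ^ n) * ((1# + c * Q ^ n) * hi n)
        ≈⟨ *-congʳ (*-congʳ (^-homo-* Q (tri n) n)) ⟨
      Q ^ tri (suc n) * z ^ suc n * hi (suc n) ∎
      where
      open 𝔽₂-Solver
      fold-const : ∀ f n → ∏.fold (λ _ → f) n ≈ f ^ n
      fold-const f zero    = refl
      fold-const f (suc n) = *-congˡ (fold-const f n)

    upper-half : ∀ N n → ∏.fold (λ i → Q ^ N + z * Q ^ (i ℕ.+ N)) n ≈ (Q ^ N) ^ n * lo n
    upper-half N zero    = sym (*-identityˡ 1#)
    upper-half N (suc n) = begin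
      (Q ^ N + z * Q ^ (n ℕ.+ N)) * ∏.fold (λ i → Q ^ N + z * Q ^ (i ℕ.+ N)) n
        ≈⟨ *-cong (+-congˡ (*-congˡ (^-homo-* Q n N))) (upper-half N n) ⟩
      (Q ^ N + z * (Q ^ n * Q ^ N)) * ((Q ^ N) ^ n * lo n)
        ≈⟨ solve 5 (λ y z u v l → (y :+ z :* (u :* y)) :* (v :* l) := y :* v :* ((con true :+ z :* u) :* l)) refl (Q ^ N) z (Q ^ n) ((Q ^ N) ^ n) (lo n) ⟩
      Q ^ N * (Q ^ N) ^ n * ((1# + z * Q ^ n) * lo n) ∎
      where open 𝔽₂-Solver

    -- The monomials pulled out of the 2N factors: Qᴺ from each upper one, z Qⁱ from each lower one.
    K : ℕ → 𝔽₂⟦q⟧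
    K N = (Q ^ N) ^ N * (Q ^ tri N * z ^ N)

    K≈q^ : ∀ N → K N ≈ q ^ (M ℕ.* N ℕ.* N ℕ.+ (M ℕ.* tri N ℕ.+ a ℕ.* N))
    K≈q^ N = sym (trans (^-homo-* q (M ℕ.* N ℕ.* N) _)
      (*-cong (trans (sym (^-assocʳ q (M ℕ.* N) N)) (^-congˡ N (sym (^-assocʳ q M N)))) (thetaTerm≈ a N)))

    K-cancel : ∀ N {f g} → K N * f ≈ K N * g → f ≈ g
    K-cancel N p = ≈[]⇒≈ λ L → q^*-cancel (M ℕ.* N ℕ.* N ℕ.+ (M ℕ.* tri N ℕ.+ a ℕ.* N))
      (≈⇒≈[] (trans (*-congʳ (sym (K≈q^ N))) (trans p (*-congʳ (K≈q^ N)))))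

    term-right : ∀ {N} j k → j ℕ.+ k ≡ N → term z (Q ^ N) (N ℕ.+ j) k ≈ K N * (Q ^ tri j * z ^ j * gauss (N ℕ.+ j) k)
    term-right {N} j k ≡.refl = begin
      Q ^ tri (N ℕ.+ j) * z ^ (N ℕ.+ j) * (Q ^ N) ^ k * G
        ≈⟨ *-congʳ (*-cong (*-cong Q^tri (^-homo-* z N j)) refl) ⟩
      Q ^ tri N * Q ^ tri j * (Q ^ N) ^ j * (z ^ N * z ^ j) * (Q ^ N) ^ k * G
        ≈⟨ solve 7 (λ t u v x w y g → t :* u :* v :* (x :* w) :* y :* g := v :* y :* (t :* x) :* (u :* w :* g)) refl
             (Q ^ tri N) (Q ^ tri j) ((Q ^ N) ^ j) (z ^ N) (z ^ j) ((Q ^ N) ^ k) G ⟩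
      (Q ^ N) ^ j * (Q ^ N) ^ k * (Q ^ tri N * z ^ N) * (Q ^ tri j * z ^ j * G)
        ≈⟨ *-congʳ (*-congʳ (^-homo-* (Q ^ N) j k)) ⟨
      K N * (Q ^ tri j * z ^ j * G) ∎
      where
      open 𝔽₂-Solver
      G : 𝔽₂⟦q⟧
      G = gauss (N ℕ.+ j) k
      Q^tri : Q ^ tri (N ℕ.+ j) ≈ Q ^ tri N * Q ^ tri j * (Q ^ N) ^ j
      Q^tri = trans (^-congʳ Q (tri-+ N j)) (trans (^-homo-* Q (tri N ℕ.+ tri j) (N ℕ.* j))
        (*-cong (^-homo-* Q (tri N) (tri j)) (sym (^-assocʳ Q N j))))

    -- Here j counts down from the middle. From Q^(Nj) = Q^(ij) Q^(j²) and j² = 2 tri j + j comes a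
    -- factor Qʲ = zʲ cʲ: its zʲ completes zᴺ, and cʲ remains.
    term-left : ∀ {N} i j → i ℕ.+ j ≡ N → term z (Q ^ N) i (j ℕ.+ N) ≈ K N * (Q ^ tri j * c ^ j * gauss i (j ℕ.+ N))
    term-left {N} i j ≡.refl = begin
      Q ^ tri i * z ^ i * (Q ^ N) ^ (j ℕ.+ N) * G
        ≈⟨ *-congʳ (*-congˡ (trans (^-homo-* (Q ^ N) j N) (*-congʳ Q^Nj))) ⟩
      Q ^ tri i * z ^ i * (Q ^ (i ℕ.* j) * (Q ^ tri j * Q ^ tri j * (z ^ j * c ^ j)) * (Q ^ N) ^ N) * G
        ≈⟨ solve 8 (λ s x u t w v y g → s :* x :* (u :* (t :* t :* (w :* v)) :* y) :* g := y :* (s :* t :* u :* (x :* w)) :* (t :* v :* g)) refl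
             (Q ^ tri i) (z ^ i) (Q ^ (i ℕ.* j)) (Q ^ tri j) (z ^ j) (c ^ j) ((Q ^ N) ^ N) G ⟩
      (Q ^ N) ^ N * (Q ^ tri i * Q ^ tri j * Q ^ (i ℕ.* j) * (z ^ i * z ^ j)) * (Q ^ tri j * c ^ j * G)
        ≈⟨ *-congʳ (*-congˡ (*-cong Q^tri (^-homo-* z i j))) ⟨
      K N * (Q ^ tri j * c ^ j * G) ∎
      where
      open 𝔽₂-Solver
      G : 𝔽₂⟦q⟧
      G = gauss i (j ℕ.+ N)
      Q^tri : Q ^ tri N ≈ Q ^ tri i * Q ^ tri j * Q ^ (i ℕ.* j)
      Q^tri = trans (^-congʳ Q (tri-+ i j)) (trans (^-homo-* Q (tri i ℕ.+ tri j) (i ℕ.* j)) (*-congʳ (^-homo-* Q (tri i) (tri j))))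
      Q^Nj : (Q ^ N) ^ j ≈ Q ^ (i ℕ.* j) * (Q ^ tri j * Q ^ tri j * (z ^ j * c ^ j))
      Q^Nj = begin
        (Q ^ N) ^ j                                              ≈⟨ ^-assocʳ Q N j ⟩
        Q ^ ((i ℕ.+ j) ℕ.* j)                                    ≈⟨ ^-congʳ Q (≡.trans (ℕₚ.*-distribʳ-+ j i j) (cong (i ℕ.* j ℕ.+_) (n*n≡2tri+n j))) ⟩
        Q ^ (i ℕ.* j ℕ.+ (tri j ℕ.+ tri j ℕ.+ j))                ≈⟨ ^-homo-* Q (i ℕ.* j) _ ⟩
        Q ^ (i ℕ.* j) * Q ^ (tri j ℕ.+ tri j ℕ.+ j)              ≈⟨ *-congˡ (trans (^-homo-* Q (tri j ℕ.+ tri j) j) (*-cong (^-homo-* Q (tri j) (tri j)) (trans (^-congˡ j (sym zc≈Q)) (^-distrib-* z c j)))) ⟩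
        Q ^ (i ℕ.* j) * (Q ^ tri j * Q ^ tri j * (z ^ j * c ^ j)) ∎

    -- The left half uses `suc k`, so that the central term occurs only in the right half.
    left right : ℕ → ℕ → ℕ → 𝔽₂⟦q⟧
    left  N i k = Q ^ tri (suc k) * c ^ suc k * gauss i (suc k ℕ.+ N)
    right N j k = Q ^ tri j * z ^ j * gauss (N ℕ.+ j) k

    -- The expansion of ∏_{i < 2N} (Qᴺ + z Qⁱ), with the common monomial K N cancelled.
    finite : ∀ n → let N = suc n in
      lo N * hi N ≈ asum (left N) n
                  + asum (right N) N
    finite n = K-cancel N (begin
      K N * (lo N * hi N)
        ≈⟨ solve 4 (λ y t l h → y :* t :* (l :* h) := y :* l :* (t :* h)) refl ((Q ^ N) ^ N) (Q ^ tri N * z ^ N) (lo N) (hi N) ⟩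
      (Q ^ N) ^ N * lo N * (Q ^ tri N * z ^ N * hi N)
        ≈⟨ *-cong (upper-half N N) (lower-half N) ⟨
      ∏.fold (λ i → t (i ℕ.+ N)) N * ∏.fold t N
        ≈⟨ ∏.fold-+ t N N ⟨
      ∏.fold t (N ℕ.+ N)
        ≈⟨ q-binomial-theorem z (Q ^ N) (N ℕ.+ N) ⟩
      asum T (N ℕ.+ N)
        ≈⟨ asum-split T n N ⟩
      asum (λ i k → T i (suc k ℕ.+ N)) n + asum (λ j k → T (N ℕ.+ j) k) N
        ≈⟨ +-cong (trans (asum-cong n λ i k i+k≡n → term-left i (suc k) (≡.trans (ℕₚ.+-suc i k) (cong suc i+k≡n))) (asum-* (K N) (left N) n))
                  (trans (asum-cong N term-right) (asum-* (K N) (right N) N)) ⟩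
      K N * asum (left N) n
        + K N * asum (right N) N
        ≈⟨ distribˡ (K N) _ _ ⟨
      K N * (asum (left N) n
        + asum (right N) N) ∎)
      where
      open 𝔽₂-Solver
      N : ℕ
      N = suc n
      t : ℕ → 𝔽₂⟦q⟧
      t i = Q ^ N + z * Q ^ i
      T : ℕ → ℕ → 𝔽₂⟦q⟧
      T = term z (Q ^ N)

    U : 𝔽₂⟦q⟧
    U = P M M

    factor≈ : ∀ k → factor M M k ≈ 1# + Q ^ suc k
    factor≈ k = +-congˡ (q^[s+n*M] M k)

    U≈poch : ∀ {l} i → l ≤ i → U ≈[ l ] poch i
    U≈poch i l≤i = ≈[]-weaken l≤i (≈[]-trans (∏.inf≈fold (factor-convergent M M) i) (≈⇒≈[] (∏.fold-cong factor≈ i)))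

    -- The limit of the Gaussian binomial is 1 / U: modulo qˡ, U² times it is
    -- `poch i * poch k * gauss i k`, hence `poch (i + k)`, hence U again.
    U*gauss≈1 : ∀ {l} i k → l ≤ i → l ≤ k → U * gauss i k ≈[ l ] 1#
    U*gauss≈1 {l} i k l≤i l≤k = *-cancelˡ-[] U (P-unit M M)
      (≈[]-trans (≈⇒≈[] (sym (*-assoc U U (gauss i k))))
      (≈[]-trans (*-cong-[] (*-cong-[] (U≈poch i l≤i) (U≈poch k l≤k)) (≈⇒≈[] refl))
      (≈[]-trans (≈⇒≈[] (poch-gauss i k))
      (≈[]-trans (≈[]-sym (U≈poch (i ℕ.+ k) (ℕₚ.≤-trans l≤i (ℕₚ.m≤m+n i k)))) (≈⇒≈[] (sym (*-identityʳ U)))))))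

    -- Near the ends of the antidiagonal the binomial is known only to low precision l, but there j
    -- is large, and the monomial adds at least j to the precision.
    U*term≈ : ∀ {N} s .{{_ : NonZero s}} i k j l → l ≤ i → l ≤ k → N ≤ j ℕ.+ l →
              U * (Q ^ tri j * (q ^ s) ^ j * gauss i k) ≈[ N ] thetaTerm M s j
    U*term≈ {N} s i k j l l≤i l≤k N≤j+l =
      ≈[]-trans (≈⇒≈[] (trans (solve 3 (λ u e g → u :* (e :* g) := e :* (u :* g)) refl U (Q ^ tri j * (q ^ s) ^ j) (gauss i k)) (*-congʳ (sym (thetaTerm≈ s j)))))
      (≈[]-trans (≈[]-weaken bound (*-cong-q^ _ (U*gauss≈1 i k l≤i l≤k))) (≈⇒≈[] (*-identityʳ _)))
      where
      open 𝔽₂-Solver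
      bound : N ≤ M ℕ.* tri j ℕ.+ s ℕ.* j ℕ.+ l
      bound = ℕₚ.≤-trans N≤j+l (ℕₚ.+-monoˡ-≤ l (ℕₚ.≤-trans (ℕₚ.m≤n*m j s) (ℕₚ.m≤n+m _ (M ℕ.* tri j))))

    P≈fold : ∀ s N → P M s ≈[ N ] ∏.fold (λ k → 1# + q ^ s * Q ^ k) N
    P≈fold s N = ≈[]-trans (∏.inf≈fold (factor-convergent M s) N) (≈⇒≈[] (∏.fold-cong (λ k → +-congˡ (q^[s+n*M] s k)) N))

  tripleProduct : P M M * (P M a * P M b) ≈ 1# + H M a + H M b
  tripleProduct = ≈[]⇒≈ λ N → ≈[]-weaken (ℕₚ.n≤1+n N) (modulo N)
    where
    open 𝔽₂-Solver
    modulo : ∀ n → P M M * (P M a * P M b) ≈[ suc n ] 1# + H M a + H M b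
    modulo n = ≈[]-trans (*-cong-[] (≈⇒≈[] refl) (*-cong-[] (P≈fold a N) (P≈fold b N)))
      (≈[]-trans (≈⇒≈[] (trans (*-congˡ (finite n)) (trans (distribˡ U _ _) (sym (+-cong (asum-* U (left N) n) (asum-* U (right N) N))))))
      (≈[]-trans (+-cong-[]
        (≈[]-trans (asum-cong-[] n λ i k i+k≡n → U*term≈ b i (suc k ℕ.+ N) (suc k) i ℕₚ.≤-refl
                      (ℕₚ.≤-trans (i≤n i k i+k≡n) (ℕₚ.≤-trans (ℕₚ.n≤1+n n) (ℕₚ.m≤n+m N (suc k))))
                      (ℕₚ.≤-reflexive (cong suc (≡.trans (≡.sym i+k≡n) (ℕₚ.+-comm i k)))))
                   (≈⇒≈[] (asum-second-index (thetaTerm M b ∘ suc) n)))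
        (≈[]-trans (asum-cong-[] N λ j k j+k≡N → U*term≈ a (N ℕ.+ j) k j k
                      (ℕₚ.≤-trans (ℕₚ.≤-trans (ℕₚ.m≤n+m k j) (ℕₚ.≤-reflexive j+k≡N)) (ℕₚ.m≤m+n N j)) ℕₚ.≤-refl
                      (ℕₚ.≤-reflexive (≡.sym j+k≡N)))
                   (≈⇒≈[] (asum-first-index (thetaTerm M a) N))))
      (≈[]-trans (≈⇒≈[] left-end)
        (+-cong-[] (+-cong-[] (≈⇒≈[] refl) (≈[]-sym (≈[]-weaken (ℕₚ.n≤1+n N) (∑.inf≈fold (thetaTerm-convergent M a) (suc N)))))
                   (≈[]-sym (≈[]-weaken (ℕₚ.n≤1+n N) (∑.inf≈fold (thetaTerm-convergent M b) (suc N))))))))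
      where
      N : ℕ
      N = suc n
      i≤n : ∀ i k → i ℕ.+ k ≡ n → i ≤ n
      i≤n i k e = ℕₚ.≤-trans (ℕₚ.m≤m+n i k) (ℕₚ.≤-reflexive e)
      F : 𝔽₂⟦q⟧
      F = ∑.fold (thetaTerm M b ∘ suc) N
      left-end : F + ∑.fold (thetaTerm M a) (suc N) ≈ 1# + ∑.fold (thetaTerm M a) (suc N) + ∑.fold (thetaTerm M b) (suc N)
      left-end = begin
        F + ∑.fold (thetaTerm M a) (suc N)
          -- F starts at j = 1; writing 0 as 1 + 1 supplies its term j = 0.
          ≈⟨ solve 2 (λ f g → f :+ g := con true :+ g :+ (con true :+ f)) refl F (∑.fold (thetaTerm M a) (suc N)) ⟩
        1# + ∑.fold (thetaTerm M a) (suc N) + (1# + F)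
          ≈⟨ +-congˡ (trans (∑.fold-first (thetaTerm M b) N) (+-congʳ (^-congʳ q (cong₂ ℕ._+_ (ℕₚ.*-zeroʳ M) (ℕₚ.*-zeroʳ b))))) ⟨
        1# + ∑.fold (thetaTerm M a) (suc N) + ∑.fold (thetaTerm M b) (suc N) ∎

open TripleProduct using (tripleProduct)

-- Splitting theta series and products by residue classes

tri-* : ∀ n d → tri (n ℕ.* d) ≡ d ℕ.* d ℕ.* tri n ℕ.+ n ℕ.* tri d
tri-* zero    d = ≡.sym (≡.trans (ℕₚ.+-identityʳ _) (ℕₚ.*-zeroʳ (d ℕ.* d)))
tri-* (suc n) d = ≡.trans (tri-+ d (n ℕ.* d)) (≡.trans (cong (λ t → tri d ℕ.+ t ℕ.+ d ℕ.* (n ℕ.* d)) (tri-* n d))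
  (solve 4 (λ n d s t → s :+ (d :* d :* t :+ n :* s) :+ d :* (n :* d) := d :* d :* (t :+ n) :+ (s :+ n :* s)) ≡.refl n d (tri d) (tri n)))
  where open Data.Nat.Solver.+-*-Solver

q^*-∑inf : ∀ m {t} → ∑.Convergent t → q ^ m * ∑.inf t ≈ ∑.inf (λ n → q ^ m * t n)
q^*-∑inf m = ∑.inf-homomorphic (q ^ m *_) (*-cong-[] (≈⇒≈[] refl)) (zeroʳ _) (distribˡ _)

-- With j = r + nd the exponent is quadratic in n; `tri-+` and `tri-*` give its coefficients.
H-blocks : ∀ p α β .{{_ : NonZero β}} → let d = suc p in
  H α β ≈ ∑.fold (λ r → q ^ (α ℕ.* tri r ℕ.+ β ℕ.* r) * H (α ℕ.* (d ℕ.* d)) (β ℕ.* d ℕ.+ α ℕ.* (tri d ℕ.+ d ℕ.* r))) d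
H-blocks p α β = trans (∑.inf-blocks p (thetaTerm-convergent α β)) (∑.fold-cong block d)
  where
  d : ℕ
  d = suc p
  block : ∀ r → ∑.inf (λ n → thetaTerm α β (r ℕ.+ n ℕ.* d))
              ≈ q ^ (α ℕ.* tri r ℕ.+ β ℕ.* r) * H (α ℕ.* (d ℕ.* d)) (β ℕ.* d ℕ.+ α ℕ.* (tri d ℕ.+ d ℕ.* r))
  block r = trans (∑.inf-cong λ n → trans (^-congʳ q (exponent n)) (^-homo-* q (α ℕ.* tri r ℕ.+ β ℕ.* r) _))
    (sym (q^*-∑inf (α ℕ.* tri r ℕ.+ β ℕ.* r) (thetaTerm-convergent (α ℕ.* (d ℕ.* d)) (β ℕ.* d ℕ.+ α ℕ.* (tri d ℕ.+ d ℕ.* r)) {{nonZero}})))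
    where
    nonZero : NonZero (β ℕ.* d ℕ.+ α ℕ.* (tri d ℕ.+ d ℕ.* r))
    nonZero = ℕ.>-nonZero (ℕₚ.≤-trans (ℕ.>-nonZero⁻¹ β) (ℕₚ.≤-trans (ℕₚ.m≤m*n β d) (ℕₚ.m≤m+n _ _)))
    exponent : ∀ n → α ℕ.* tri (r ℕ.+ n ℕ.* d) ℕ.+ β ℕ.* (r ℕ.+ n ℕ.* d)
                   ≡ α ℕ.* tri r ℕ.+ β ℕ.* r ℕ.+ (α ℕ.* (d ℕ.* d) ℕ.* tri n ℕ.+ (β ℕ.* d ℕ.+ α ℕ.* (tri d ℕ.+ d ℕ.* r)) ℕ.* n)
    exponent n = ≡.trans (cong (λ t → α ℕ.* t ℕ.+ β ℕ.* (r ℕ.+ n ℕ.* d))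
        (≡.trans (tri-+ r (n ℕ.* d)) (cong (λ t → tri r ℕ.+ t ℕ.+ r ℕ.* (n ℕ.* d)) (tri-* n d))))
      (solve 8 (λ α β r n d s t u → α :* (s :+ (d :* d :* t :+ n :* u) :+ r :* (n :* d)) :+ β :* (r :+ n :* d)
          := α :* s :+ β :* r :+ (α :* (d :* d) :* t :+ (β :* d :+ α :* (u :+ d :* r)) :* n)) ≡.refl α β r n d (tri r) (tri n) (tri d))
      where open Data.Nat.Solver.+-*-Solver

-- Removing j = 0 shifts β by α. This matches the blocks of `H-blocks` with the two halves of a
-- smaller theta series.
H-first : ∀ α β .{{_ : NonZero β}} → H α β ≈ 1# + q ^ β * H α (α ℕ.+ β)
H-first α β = trans (∑.inf-first (thetaTerm-convergent α β))
  (+-cong (^-congʳ q (cong₂ ℕ._+_ (ℕₚ.*-zeroʳ α) (ℕₚ.*-zeroʳ β)))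
    (trans (∑.inf-cong λ j → trans (^-congʳ q (exponent j)) (^-homo-* q β _))
      (sym (q^*-∑inf β (thetaTerm-convergent α (α ℕ.+ β) {{ℕ.>-nonZero (ℕₚ.≤-trans (ℕ.>-nonZero⁻¹ β) (ℕₚ.m≤n+m β α))}})))))
  where
  exponent : ∀ j → α ℕ.* tri (suc j) ℕ.+ β ℕ.* suc j ≡ β ℕ.+ (α ℕ.* tri j ℕ.+ (α ℕ.+ β) ℕ.* j)
  exponent j = solve 4 (λ α β j t → α :* (t :+ j) :+ β :* (con 1 :+ j) := β :+ (α :* t :+ (α :+ β) :* j)) ≡.refl α β j (tri j)
    where open Data.Nat.Solver.+-*-Solver

φ-H : ∀ p α β .{{_ : NonZero β}} → φ (suc p) (H α β) ≈ H (suc p ℕ.* α) (suc p ℕ.* β)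
φ-H p α β = trans (∑.inf-homomorphic (φ (suc p)) (φ-cong-[] p) (φ-0 p) (φ-+ p) (thetaTerm-convergent α β))
  (∑.inf-cong λ j → trans (φ-q^ p (α ℕ.* tri j ℕ.+ β ℕ.* j)) (^-congʳ q (exponent j)))
  where
  exponent : ∀ j → suc p ℕ.* (α ℕ.* tri j ℕ.+ β ℕ.* j) ≡ suc p ℕ.* α ℕ.* tri j ℕ.+ suc p ℕ.* β ℕ.* j
  exponent j = solve 5 (λ d α β j t → d :* (α :* t :+ β :* j) := d :* α :* t :+ d :* β :* j) ≡.refl (suc p) α β j (tri j)
    where open Data.Nat.Solver.+-*-Solver

P-blocks : ∀ p M s .{{_ : NonZero M}} → P M s ≈ ∏.fold (λ r → P (suc p ℕ.* M) (s ℕ.+ r ℕ.* M)) (suc p)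
P-blocks p M s = trans (∏.inf-blocks p (factor-convergent M s))
  (∏.fold-cong (λ r → ∏.inf-cong λ n → +-congˡ (^-congʳ q (exponent r n))) (suc p))
  where
  exponent : ∀ r n → s ℕ.+ (r ℕ.+ n ℕ.* suc p) ℕ.* M ≡ s ℕ.+ r ℕ.* M ℕ.+ n ℕ.* (suc p ℕ.* M)
  exponent r n = solve 5 (λ s r n d M → s :+ (r :+ n :* d) :* M := s :+ r :* M :+ n :* (d :* M)) ≡.refl s r n (suc p) M
    where open Data.Nat.Solver.+-*-Solver

-- Frobenius in characteristic 2, applied to each factor.
P-square : ∀ M s .{{_ : NonZero M}} → P M s * P M s ≈ P (2 ℕ.* M) (2 ℕ.* s)
P-square M s = trans (sym (∏.inf-∙ (factor-convergent M s) (factor-convergent M s)))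
  (∏.inf-cong λ n → trans (solve 1 (λ u → (con true :+ u) :* (con true :+ u) := con true :+ u :^ 2) refl (q ^ (s ℕ.+ n ℕ.* M)))
    (+-congˡ (trans (^-assocʳ q (s ℕ.+ n ℕ.* M) 2) (^-congʳ q (exponent n)))))
  where
  open 𝔽₂-Solver
  exponent : ∀ n → (s ℕ.+ n ℕ.* M) ℕ.* 2 ≡ 2 ℕ.* s ℕ.+ n ℕ.* (2 ℕ.* M)
  exponent n = ℕsolve 3 (λ s n M → (s ℕ:+ n ℕ:* M) ℕ:* ℕcon 2 ℕ:= ℕcon 2 ℕ:* s ℕ:+ n ℕ:* (ℕcon 2 ℕ:* M)) ≡.refl s n M
    where open Data.Nat.Solver.+-*-Solver renaming (solve to ℕsolve; _:+_ to _ℕ:+_; _:*_ to _ℕ:*_; _:=_ to _ℕ:=_; con to ℕcon)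

-- The identities of Euler and Jacobi modulo 2 and their dissections

E : 𝔽₂⟦q⟧
E = P 1 1

E-unit : E 0 ≡ true
E-unit = P-unit 1 1

φ-E : ∀ p → φ (suc p) E ≈ P (suc p) (suc p)
φ-E p = trans (∏.inf-homomorphic (φ (suc p)) (φ-cong-[] p) (φ-1 p) (φ-* p) (factor-convergent 1 1))
  (∏.inf-cong λ n → trans (φ-+ p _ _) (+-cong (φ-1 p) (trans (φ-q^ p (1 ℕ.+ n ℕ.* 1)) (^-congʳ q (exponent n)))))
  where
  exponent : ∀ n → suc p ℕ.* (1 ℕ.+ n ℕ.* 1) ≡ suc p ℕ.+ n ℕ.* suc p
  exponent n = solve 2 (λ d n → d :* (con 1 :+ n :* con 1) := d :+ n :* d) ≡.refl (suc p) n
    where open Data.Nat.Solver.+-*-Solver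

-- The factors of E sorted modulo 3 form the triple product with a = 1, b = 2.
euler : E ≈ 1# + H 3 1 + H 3 2
euler = trans (P-blocks 2 1 1) (trans
  (*-congˡ (trans (*-congˡ (*-identityʳ _)) (*-comm _ _))) (tripleProduct 1 2))

jacobi : E ^ 3 ≈ H 1 1
jacobi = *-cancelˡ (E * E) (≡.trans (*-coeff₀ E E) (cong₂ _∧_ E-unit E-unit)) (begin
  E * E * E ^ 3
    ≈⟨ solve 1 (λ e → e :* e :* e :^ 3 := (e :* e) :* (e :* e) :* e) refl E ⟩
  (E * E) * (E * E) * E
    ≈⟨ *-congˡ E≈ ⟩
  (E * E) * (E * E) * (E * E * (P 4 1 * P 4 3))
    ≈⟨ solve 2 (λ e u → (e :* e) :* (e :* e) :* (e :* e :* u) := e :* e :* ((e :* e) :* (e :* e) :* u)) refl E (P 4 1 * P 4 3) ⟩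
  E * E * ((E * E) * (E * E) * (P 4 1 * P 4 3))
    ≈⟨ *-congˡ (*-congʳ (trans (*-cong (P-square 1 1) (P-square 1 1)) (P-square 2 2))) ⟩
  E * E * (P 4 4 * (P 4 1 * P 4 3))
    ≈⟨ *-congˡ (tripleProduct 1 3) ⟩
  E * E * (1# + H 4 1 + H 4 3)
    ≈⟨ *-congˡ (+-congʳ (+-congˡ (H-first 4 1))) ⟩
  E * E * (1# + (1# + q ^ 1 * H 4 5) + H 4 3)
    ≈⟨ *-congˡ (solve 3 (λ q u v → con true :+ (con true :+ q :^ 1 :* u) :+ v := q :^ 1 :* u :+ (con true :* v :+ con false)) refl q (H 4 5) (H 4 3)) ⟩
  E * E * (q ^ 1 * H 4 5 + (1# * H 4 3 + 0#))
    ≈⟨ *-congˡ (H-blocks 1 1 1) ⟨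
  E * E * H 1 1 ∎)
  where
  open 𝔽₂-Solver
  E≈ : E ≈ E * E * (P 4 1 * P 4 3)
  E≈ = trans (P-blocks 1 1 1) (*-cong (sym (P-square 1 1))
    (trans (*-identityʳ _) (trans (P-blocks 1 2 1) (trans (*-congˡ (*-identityʳ _)) (*-comm _ _)))))

-- Modulo 3 the triangular numbers are 0 or 1. Those in class 1 are 9T + 1 with T triangular; those
-- in class 0 recombine into Euler's series.
E³-3-dissection : E ^ 3 ≈ φ 3 E + q * φ 3 (φ 3 (E ^ 3))
E³-3-dissection = begin
  E ^ 3
    ≈⟨ trans jacobi (H-blocks 2 1 1) ⟩
  q ^ 3 * H 9 12 + (q ^ 1 * H 9 9 + (1# * H 9 6 + 0#))
    ≈⟨ solve 4 (λ q u v w → q :^ 3 :* u :+ (q :^ 1 :* v :+ (con true :* w :+ con false))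
                 := con true :+ (con true :+ q :^ 3 :* u) :+ w :+ q :* v) refl q (H 9 12) (H 9 9) (H 9 6) ⟩
  1# + (1# + q ^ 3 * H 9 12) + H 9 6 + q * H 9 9
    ≈⟨ +-cong (+-cong (+-cong (φ-1 2) (trans (φ-H 2 3 1) (H-first 9 3))) (φ-H 2 3 2))
              (*-congˡ (trans (φ-cong 2 (trans (φ-cong 2 jacobi) (φ-H 2 1 1))) (φ-H 2 3 3))) ⟨
  φ 3 1# + φ 3 (H 3 1) + φ 3 (H 3 2) + q * φ 3 (φ 3 (E ^ 3))
    ≈⟨ +-congʳ (trans (φ-cong 2 euler) (trans (φ-+ 2 _ _) (+-congʳ (φ-+ 2 _ _)))) ⟨
  φ 3 E + q * φ 3 (φ 3 (E ^ 3)) ∎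
  where open 𝔽₂-Solver

-- K and L are the sections 0 and 1 modulo 5 of E³; A and C are the sections 0 and 2 of E.
K L A C : 𝔽₂⟦q⟧
K = 1# + H 5 2 + H 5 3
L = 1# + H 5 1 + H 5 4
A = 1# + H 15 7 + q * H 15 13 + H 15 8 + q ^ 3 * H 15 17
C = H 15 11 + q * H 15 14 + q ^ 2 * H 15 16 + q ^ 4 * H 15 19

-- Both are triple products in base q⁵. Together they contain each nonzero residue modulo 5 once and
-- residue 0 twice, and the repeated factor is E(q⁵).
KL≈Eφ₅E : K * L ≈ E * φ 5 E
KL≈Eφ₅E = begin
  K * L
    ≈⟨ *-cong (tripleProduct 2 3) (tripleProduct 1 4) ⟨
  P 5 5 * (P 5 2 * P 5 3) * (P 5 5 * (P 5 1 * P 5 4))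
    ≈⟨ solve 5 (λ a b c d e → e :* (b :* c) :* (e :* (a :* d)) := e :* (d :* (c :* (b :* (a :* con true)))) :* e) refl
         (P 5 1) (P 5 2) (P 5 3) (P 5 4) (P 5 5) ⟩
  P 5 5 * (P 5 4 * (P 5 3 * (P 5 2 * (P 5 1 * 1#)))) * P 5 5
    ≈⟨ *-cong (P-blocks 4 1 1) (φ-E 4) ⟨
  E * φ 5 E ∎
  where open 𝔽₂-Solver

-- For j = 0, ..., 4 the numbers j(j+1)/2 are 0, 1, 3, 1, 0 modulo 5; those in class 3 are 25T + 3
-- with T triangular.
E³-5-dissection : E ^ 3 ≈ φ 5 K + q * φ 5 L + q ^ 3 * φ 5 (φ 5 (E ^ 3))
E³-5-dissection = begin
  E ^ 3
    ≈⟨ trans jacobi (H-blocks 4 1 1) ⟩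
  q ^ 10 * H 25 35 + (q ^ 6 * H 25 30 + (q ^ 3 * H 25 25 + (q ^ 1 * H 25 20 + (1# * H 25 15 + 0#))))
    ≈⟨ solve 6 (λ q u v w x y → q :^ 10 :* u :+ (q :^ 6 :* v :+ (q :^ 3 :* w :+ (q :^ 1 :* x :+ (con true :* y :+ con false))))
                 := con true :+ (con true :+ q :^ 10 :* u) :+ y :+ q :* (con true :+ (con true :+ q :^ 5 :* v) :+ x) :+ q :^ 3 :* w)
         refl q (H 25 35) (H 25 30) (H 25 25) (H 25 20) (H 25 15) ⟩
  1# + (1# + q ^ 10 * H 25 35) + H 25 15 + q * (1# + (1# + q ^ 5 * H 25 30) + H 25 20) + q ^ 3 * H 25 25
    ≈⟨ +-cong (+-cong (φ-Θ 2 3 (trans (φ-H 4 5 2) (H-first 25 10)) (φ-H 4 5 3)) (*-congˡ (φ-Θ 1 4 (trans (φ-H 4 5 1) (H-first 25 5)) (φ-H 4 5 4))))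
              (*-congˡ (trans (φ-cong 4 (trans (φ-cong 4 jacobi) (φ-H 4 1 1))) (φ-H 4 5 5))) ⟨
  φ 5 K + q * φ 5 L + q ^ 3 * φ 5 (φ 5 (E ^ 3)) ∎
  where
  open 𝔽₂-Solver
  φ-Θ : ∀ a b {f g} → φ 5 (H 5 a) ≈ f → φ 5 (H 5 b) ≈ g → φ 5 (1# + H 5 a + H 5 b) ≈ 1# + f + g
  φ-Θ a b p r = trans (φ-+ 4 _ _) (+-cong (trans (φ-+ 4 _ _) (+-cong (φ-1 4) p)) r)

-- Generalized pentagonal numbers are 0, 1 or 2 modulo 5, and those in class 1 are 25 times a
-- pentagonal number plus 1.
E-5-dissection : E ≈ φ 5 A + q * φ 5 (φ 5 E) + q ^ 2 * φ 5 C
E-5-dissection = begin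
  E
    ≈⟨ trans euler (+-cong (+-congˡ (H-blocks 4 3 1)) (H-blocks 4 3 2)) ⟩
  1# + (q ^ 22 * H 75 95 + (q ^ 12 * H 75 80 + (q ^ 5 * H 75 65 + (q ^ 1 * H 75 50 + (1# * H 75 35 + 0#)))))
     + (q ^ 26 * H 75 100 + (q ^ 15 * H 75 85 + (q ^ 7 * H 75 70 + (q ^ 2 * H 75 55 + (1# * H 75 40 + 0#)))))
    ≈⟨ solve 11 (λ q a b c d e f g h i j →
         con true :+ (q :^ 22 :* e :+ (q :^ 12 :* d :+ (q :^ 5 :* c :+ (q :^ 1 :* b :+ (con true :* a :+ con false)))))
           :+ (q :^ 26 :* j :+ (q :^ 15 :* i :+ (q :^ 7 :* h :+ (q :^ 2 :* g :+ (con true :* f :+ con false)))))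
         := con true :+ a :+ q :^ 5 :* c :+ f :+ (q :^ 5) :^ 3 :* i
            :+ q :* (con true :+ (con true :+ q :^ 25 :* j) :+ b)
            :+ q :^ 2 :* (g :+ q :^ 5 :* h :+ (q :^ 5) :^ 2 :* d :+ (q :^ 5) :^ 4 :* e))
         refl q (H 75 35) (H 75 50) (H 75 65) (H 75 80) (H 75 95) (H 75 40) (H 75 55) (H 75 70) (H 75 85) (H 75 100) ⟩
  1# + H 75 35 + q ^ 5 * H 75 65 + H 75 40 + (q ^ 5) ^ 3 * H 75 85
    + q * (1# + (1# + q ^ 25 * H 75 100) + H 75 50)
    + q ^ 2 * (H 75 55 + q ^ 5 * H 75 70 + (q ^ 5) ^ 2 * H 75 80 + (q ^ 5) ^ 4 * H 75 95)
    ≈⟨ +-cong (+-cong φA (*-congˡ φφE)) (*-congˡ φC) ⟨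
  φ 5 A + q * φ 5 (φ 5 E) + q ^ 2 * φ 5 C ∎
  where
  open 𝔽₂-Solver
  v₀ v₁ v₂ v₃ v₄ : Polynomial 5
  v₀ = var (# 0)
  v₁ = var (# 1)
  v₂ = var (# 2)
  v₃ = var (# 3)
  v₄ = var (# 4)

  φA : φ 5 A ≈ 1# + H 75 35 + q ^ 5 * H 75 65 + H 75 40 + (q ^ 5) ^ 3 * H 75 85
  φA = φ-polynomial 4 (con true :+ v₁ :+ v₀ :* v₂ :+ v₃ :+ v₀ :^ 3 :* v₄)
    (q ∷ H 15 7 ∷ H 15 13 ∷ H 15 8 ∷ H 15 17 ∷ []) (q ^ 5 ∷ H 75 35 ∷ H 75 65 ∷ H 75 40 ∷ H 75 85 ∷ [])
    λ { zero → φ-q 4 ; (suc zero) → φ-H 4 15 7 ; (suc (suc zero)) → φ-H 4 15 13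
      ; (suc (suc (suc zero))) → φ-H 4 15 8 ; (suc (suc (suc (suc zero)))) → φ-H 4 15 17 }

  φC : φ 5 C ≈ H 75 55 + q ^ 5 * H 75 70 + (q ^ 5) ^ 2 * H 75 80 + (q ^ 5) ^ 4 * H 75 95
  φC = φ-polynomial 4 (v₁ :+ v₀ :* v₂ :+ v₀ :^ 2 :* v₃ :+ v₀ :^ 4 :* v₄)
    (q ∷ H 15 11 ∷ H 15 14 ∷ H 15 16 ∷ H 15 19 ∷ []) (q ^ 5 ∷ H 75 55 ∷ H 75 70 ∷ H 75 80 ∷ H 75 95 ∷ [])
    λ { zero → φ-q 4 ; (suc zero) → φ-H 4 15 11 ; (suc (suc zero)) → φ-H 4 15 14
      ; (suc (suc (suc zero))) → φ-H 4 15 16 ; (suc (suc (suc (suc zero)))) → φ-H 4 15 19 }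

  φφH : ∀ β .{{_ : NonZero β}} .{{_ : NonZero (5 ℕ.* β)}} → φ 5 (φ 5 (H 3 β)) ≈ H 75 (5 ℕ.* (5 ℕ.* β))
  φφH β = trans (φ-cong 4 (φ-H 4 3 β)) (φ-H 4 15 (5 ℕ.* β))

  φφE : φ 5 (φ 5 E) ≈ 1# + (1# + q ^ 25 * H 75 100) + H 75 50
  φφE = trans (φ-cong 4 (trans (φ-cong 4 euler) (trans (φ-+ 4 _ _) (+-congʳ (φ-+ 4 _ _)))))
    (trans (φ-+ 4 _ _) (+-cong (trans (φ-+ 4 _ _) (+-cong (trans (φ-cong 4 (φ-1 4)) (φ-1 4)) (trans (φφH 1) (H-first 75 25)))) (φφH 2)))

-- Two sections of an inverse power series

module Sections (p : ℕ) (X h y : 𝔽₂⟦q⟧) (hX≈1 : h * X ≈ 1#) (yY≈1 : y * φ (suc p) X ≈ 1#)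
  (modular : X ^ suc (suc p) ≈ X * φ (suc p) X + q * φ (suc p) X ^ suc (suc p))
  (sec-X^ : ∀ j → suc j < suc p → sec (suc p) (suc j) (X ^ suc j) ≈ φ (suc p) X ^ suc j)
  (sec₀-X^ : sec (suc p) 0 (X ^ suc p) ≈ X + q * φ (suc p) X ^ suc p) where

  private
    a : ℕ
    a = suc p
    Y ρ : 𝔽₂⟦q⟧
    Y = φ a X
    ρ = Y * h ^ a

    -- This is D = 0 times hⁿ⁺¹, with h X = 1 used to absorb powers of X.
    modular-h : ∀ m n → m ℕ.+ suc n ≡ suc a → q * (Y ^ suc a * h ^ suc n) ≈ X ^ m + Y * h ^ n
    modular-h m n m+1+n≡1+a = begin
      q * (Y ^ suc a * h ^ suc n)
        ≈⟨ solve 5 (λ q u h v xy → q :* (u :* (h :* v)) := ((xy :+ q :* u) :+ xy) :* (h :* v)) refl q (Y ^ suc a) h (h ^ n) (X * Y) ⟩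
      ((X * Y + q * Y ^ suc a) + X * Y) * (h * h ^ n)
        ≈⟨ *-congʳ (+-congʳ (trans (sym modular) (trans (^-congʳ X (≡.sym m+1+n≡1+a)) (^-homo-* X m (suc n))))) ⟩
      (X ^ m * X ^ suc n + X * Y) * (h * h ^ n)
        ≈⟨ solve 6 (λ u v x y h w → (u :* v :+ x :* y) :* (h :* w) := u :* ((h :* w) :* v) :+ (h :* x) :* (y :* w)) refl (X ^ m) (X ^ suc n) X Y h (h ^ n) ⟩
      X ^ m * (h ^ suc n * X ^ suc n) + (h * X) * (Y * h ^ n)
        ≈⟨ +-cong (trans (*-congˡ (inverse-^ (suc n) hX≈1)) (*-identityʳ _)) (trans (*-congʳ hX≈1) (*-identityˡ _)) ⟩
      X ^ m + Y * h ^ n ∎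
      where open 𝔽₂-Solver

    sec-Y^* : ∀ r k f → r < a → sec a r (Y ^ k * f) ≈ X ^ k * sec a r f
    sec-Y^* r k f r<a = trans (sec-cong a r (*-congʳ (sym (φ-^ p X k)))) (sec-φ* p r (X ^ k) f r<a)

    sec-Y* : ∀ r f → r < a → sec a r (Y * f) ≈ X * sec a r f
    sec-Y* r f r<a = sec-φ* p r X f r<a

    p<a : p < a
    p<a = ℕₚ.≤-refl

    -- Removes the power Xᵃ⁺¹ that Yᵃ⁺¹ turns into when it leaves a section.
    divide : ∀ {f g} → X ^ suc a * f ≈ g → f ≈ h ^ suc a * g
    divide {f} {g} e = begin
      f                             ≈⟨ *-identityˡ f ⟨
      1# * f                        ≈⟨ *-congʳ (inverse-^ (suc a) hX≈1) ⟨
      h ^ suc a * X ^ suc a * f     ≈⟨ *-assoc _ _ _ ⟩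
      h ^ suc a * (X ^ suc a * f)   ≈⟨ *-congˡ e ⟩
      h ^ suc a * g                 ∎

    -- Class 0 of the equation with n = 0. The section of Xᵃ and that of Y each contribute X, and
    -- these cancel.
    sec-h : sec a p (h ^ 1) ≈ h ^ suc a * Y ^ a
    sec-h = divide (q*-injective (begin
      q * (X ^ suc a * sec a p (h ^ 1))            ≈⟨ *-congˡ (sec-Y^* p (suc a) (h ^ 1) p<a) ⟨
      q * sec a p (Y ^ suc a * h ^ 1)              ≈⟨ sec-zero-q* p _ ⟨
      sec a 0 (q * (Y ^ suc a * h ^ 1))            ≈⟨ sec-cong a 0 (modular-h a 0 (ℕₚ.+-comm a 1)) ⟩
      sec a 0 (X ^ a + Y * 1#)                     ≈⟨ sec-+ a 0 _ _ ⟩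
      sec a 0 (X ^ a) + sec a 0 (Y * 1#)           ≈⟨ +-cong sec₀-X^ (trans (sec-cong a 0 (*-identityʳ Y)) (sec₀-φ p X)) ⟩
      X + q * Y ^ a + X                            ≈⟨ solve 2 (λ x u → x :+ u :+ x := u) refl X (q * Y ^ a) ⟩
      q * Y ^ a                                    ∎))
      where open 𝔽₂-Solver

    qYh≈1+ρ : q * (Y ^ suc a * h ^ suc a) ≈ 1# + ρ
    qYh≈1+ρ = modular-h 0 a ≡.refl

    -- After scaling by q and a power of Y the recursion is t ↦ 1 + ρ + ρ t. Starting from 1 + ρ it
    -- telescopes to 1 + ρʲ.
    sec-h^ : ∀ j r → suc j ℕ.+ r ≡ a → q * (Y ^ suc j * sec a r (h ^ suc j)) ≈ 1# + ρ ^ suc j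
    sec-h^ zero r ≡.refl = begin
      q * (Y ^ 1 * sec a p (h ^ 1))          ≈⟨ *-congˡ (*-congˡ sec-h) ⟩
      q * (Y ^ 1 * (h ^ suc a * Y ^ a))      ≈⟨ solve 4 (λ q y u v → q :* (y :^ 1 :* (u :* v)) := q :* ((y :* v) :* u)) refl q Y (h ^ suc a) (Y ^ a) ⟩
      q * (Y ^ suc a * h ^ suc a)            ≈⟨ qYh≈1+ρ ⟩
      1# + ρ                                 ≈⟨ +-congˡ (*-identityʳ ρ) ⟨
      1# + ρ ^ 1                             ∎
      where open 𝔽₂-Solver
    sec-h^ (suc j) r 2+j+r≡a = begin
      q * (Y ^ suc (suc j) * sec a r (h ^ suc (suc j)))
        ≈⟨ *-congˡ (*-congˡ recursion) ⟩
      q * (Y * Y ^ suc j * (h * h ^ a * (Y ^ suc r + X * S)))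
        ≈⟨ solve 8 (λ q y u h v w x s → q :* (y :* u :* (h :* v :* (w :+ x :* s)))
              := q :* ((y :* u :* w) :* (h :* v)) :+ (h :* x) :* (y :* v) :* (q :* (u :* s))) refl q Y (Y ^ suc j) h (h ^ a) (Y ^ suc r) X S ⟩
      q * ((Y * Y ^ suc j * Y ^ suc r) * h ^ suc a) + (h * X) * ρ * (q * (Y ^ suc j * S))
        ≈⟨ +-cong (trans (*-congˡ (*-congʳ Y-powers)) qYh≈1+ρ)
                  (*-cong (trans (*-congʳ hX≈1) (*-identityˡ ρ)) (sec-h^ j (suc r) 1+j+1+r≡a)) ⟩
      1# + ρ + ρ * (1# + ρ ^ suc j)
        ≈⟨ solve 2 (λ r u → con true :+ r :+ r :* (con true :+ u) := con true :+ r :* u) refl ρ (ρ ^ suc j) ⟩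
      1# + ρ ^ suc (suc j) ∎
      where
      open 𝔽₂-Solver
      1+j+1+r≡a : suc j ℕ.+ suc r ≡ a
      1+j+1+r≡a = ≡.trans (ℕₚ.+-suc (suc j) r) 2+j+r≡a
      1+r<a : suc r < a
      1+r<a = ≡.subst (suc r <_) 1+j+1+r≡a (s≤s (ℕₚ.m≤n+m (suc r) j))
      S : 𝔽₂⟦q⟧
      S = sec a (suc r) (h ^ suc j)
      Y-powers : Y * Y ^ suc j * Y ^ suc r ≈ Y ^ suc a
      Y-powers = trans (*-assoc _ _ _) (*-congˡ (trans (sym (^-homo-* Y (suc j) (suc r))) (^-congʳ Y 1+j+1+r≡a)))
      recursion : sec a r (h ^ suc (suc j)) ≈ h ^ suc a * (Y ^ suc r + X * S)
      recursion = divide (begin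
        X ^ suc a * sec a r (h ^ suc (suc j))                  ≈⟨ sec-Y^* r (suc a) _ (ℕₚ.≤-trans (ℕₚ.n≤1+n (suc r)) 1+r<a) ⟨
        sec a r (Y ^ suc a * h ^ suc (suc j))                  ≈⟨ sec-suc-q* a r _ ⟨
        sec a (suc r) (q * (Y ^ suc a * h ^ suc (suc j)))      ≈⟨ sec-cong a (suc r) (modular-h (suc r) (suc j)
                                                                    (cong suc (≡.trans (ℕₚ.+-comm r (suc (suc j))) 2+j+r≡a))) ⟩
        sec a (suc r) (X ^ suc r + Y * h ^ suc j)              ≈⟨ sec-+ a (suc r) _ _ ⟩
        sec a (suc r) (X ^ suc r) + sec a (suc r) (Y * h ^ suc j) ≈⟨ +-cong (sec-X^ r 1+r<a) (sec-Y* (suc r) _ 1+r<a) ⟩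
        Y ^ suc r + X * S                                      ∎)

    S₀ : 𝔽₂⟦q⟧
    S₀ = sec a 0 (h ^ a)

    -- The equation with n = a has X⁰ = 1 on the right, so its class 0 needs only the case j = a of
    -- the recursion.
    sec-h^[1+a] : q * (X ^ suc a * sec a p (h ^ suc a)) ≈ 1# + X * S₀
    sec-h^[1+a] = begin
      q * (X ^ suc a * sec a p (h ^ suc a))      ≈⟨ *-congˡ (sec-Y^* p (suc a) _ p<a) ⟨
      q * sec a p (Y ^ suc a * h ^ suc a)        ≈⟨ sec-zero-q* p _ ⟨
      sec a 0 (q * (Y ^ suc a * h ^ suc a))      ≈⟨ sec-cong a 0 qYh≈1+ρ ⟩
      sec a 0 (1# + Y * h ^ a)                   ≈⟨ sec-+ a 0 _ _ ⟩
      sec a 0 1# + sec a 0 (Y * h ^ a)           ≈⟨ +-cong (sec₀-1 p) (sec-Y* 0 _ (s≤s z≤n)) ⟩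
      1# + X * S₀                                ∎

    qS₀ : q * S₀ ≈ y ^ a + h ^ (a ℕ.* a)
    qS₀ = begin
      q * S₀                        ≈⟨ *-identityˡ _ ⟨
      1# * (q * S₀)                 ≈⟨ *-congʳ (inverse-^ a yY≈1) ⟨
      y ^ a * Y ^ a * (q * S₀)      ≈⟨ solve 4 (λ u v q s → u :* v :* (q :* s) := u :* (q :* (v :* s))) refl (y ^ a) (Y ^ a) q S₀ ⟩
      y ^ a * (q * (Y ^ a * S₀))    ≈⟨ *-congˡ (sec-h^ p 0 (ℕₚ.+-identityʳ a)) ⟩
      y ^ a * (1# + ρ ^ a)          ≈⟨ *-congˡ (+-congˡ (^-distrib-* Y (h ^ a) a)) ⟩
      y ^ a * (1# + Y ^ a * (h ^ a) ^ a)   ≈⟨ solve 3 (λ u v w → u :* (con true :+ v :* w) := u :+ u :* v :* w) refl (y ^ a) (Y ^ a) ((h ^ a) ^ a) ⟩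
      y ^ a + y ^ a * Y ^ a * (h ^ a) ^ a  ≈⟨ +-congˡ (trans (*-congʳ (inverse-^ a yY≈1)) (*-identityˡ _)) ⟩
      y ^ a + (h ^ a) ^ a                  ≈⟨ +-congˡ (^-assocʳ h a a) ⟩
      y ^ a + h ^ (a ℕ.* a) ∎
      where open 𝔽₂-Solver

  sec-sec : q ^ 2 * sec a p (sec a p h) ≈ h ^ (a ℕ.* a) + y ^ a + q * h
  sec-sec = begin
    q ^ 2 * sec a p (sec a p h)
      ≈⟨ *-congˡ (sec-cong a p (trans (sec-cong a p (sym (*-identityʳ h))) (trans sec-h (*-comm _ _)))) ⟩
    q ^ 2 * sec a p (Y ^ a * h ^ suc a)
      ≈⟨ *-congˡ (sec-Y^* p a _ p<a) ⟩
    q ^ 2 * (X ^ a * s)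
      ≈⟨ *-identityˡ _ ⟨
    1# * (q ^ 2 * (X ^ a * s))
      -- The inserted factor h X completes Xᵃ to the power Xᵃ⁺¹ of `sec-h^[1+a]` and leaves the h of
      -- the term q h.
      ≈⟨ *-congʳ hX≈1 ⟨
    h * X * (q ^ 2 * (X ^ a * s))
      ≈⟨ solve 5 (λ h x q u s → h :* x :* (q :^ 2 :* (u :* s)) := q :* h :* (q :* (x :* u :* s))) refl h X q (X ^ a) s ⟩
    q * h * (q * (X ^ suc a * s))
      ≈⟨ *-congˡ sec-h^[1+a] ⟩
    q * h * (1# + X * S₀)
      ≈⟨ solve 4 (λ q h x s → q :* h :* (con true :+ x :* s) := (h :* x) :* (q :* s) :+ q :* h) refl q h X S₀ ⟩
    (h * X) * (q * S₀) + q * h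
      ≈⟨ +-congʳ (trans (*-congʳ hX≈1) (trans (*-identityˡ _) (trans qS₀ (+-comm _ _)))) ⟩
    h ^ (a ℕ.* a) + y ^ a + q * h ∎
    where
    open 𝔽₂-Solver
    s : 𝔽₂⟦q⟧
    s = sec a p (h ^ suc a)

open Sections using (sec-sec)

-- The modular equations of degrees 3 and 5

horner : List 𝔽₂⟦q⟧ → 𝔽₂⟦q⟧
horner []       = 0#
horner (f ∷ fs) = f + q * horner fs

module _ (p : ℕ) {n : ℕ} (ρ ρ′ : Vec 𝔽₂⟦q⟧ n) (φρ≈ρ′ : ∀ i → φ (suc p) (lookup ρ i) ≈ lookup ρ′ i) where
  open 𝔽₂-Solver

  interleave-polynomials : ∀ Ps → interleave p (List.map (λ P → ⟦ P ⟧ ρ) Ps) ≈ horner (List.map (λ P → ⟦ P ⟧ ρ′) Ps)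
  interleave-polynomials []       = refl
  interleave-polynomials (P ∷ Ps) = +-cong (φ-polynomial p P ρ ρ′ φρ≈ρ′) (*-congˡ (interleave-polynomials Ps))

  -- If f is dissected with coefficients that are polynomials in ρ′ = φ(ρ), its sections are the
  -- same polynomials in ρ.
  sec-polynomials : ∀ {f} Ps → f ≈ horner (List.map (λ P → ⟦ P ⟧ ρ′) Ps) → length (List.map (λ P → ⟦ P ⟧ ρ) Ps) ≤ suc p →
                    ∀ r → r < suc p → sec (suc p) r f ≈ nth (List.map (λ P → ⟦ P ⟧ ρ) Ps) r
  sec-polynomials Ps f≈ len≤ r r<d = trans (sec-cong (suc p) r (trans f≈ (sym (interleave-polynomials Ps)))) (sec-interleave p (List.map (λ P → ⟦ P ⟧ ρ) Ps) r len≤ r<d)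

module Degree3 where
  open 𝔽₂-Solver

  X Y e Z : 𝔽₂⟦q⟧
  X = E ^ 3
  Y = φ 3 X
  e = φ 3 E
  Z = φ 3 Y

  private
    ρ ρ′ : Vec 𝔽₂⟦q⟧ 3
    ρ  = q ∷ E ∷ Y ∷ []
    ρ′ = q ^ 3 ∷ e ∷ Z ∷ []

    φρ≈ρ′ : ∀ i → φ 3 (lookup ρ i) ≈ lookup ρ′ i
    φρ≈ρ′ zero             = φ-q 2
    φρ≈ρ′ (suc zero)       = refl
    φρ≈ρ′ (suc (suc zero)) = refl

    v₀ v₁ v₂ : Polynomial 3
    v₀ = var (# 0)
    v₁ = var (# 1)
    v₂ = var (# 2)

    X≈ : X ≈ e + q * Z
    X≈ = E³-3-dissection

  sec-X^ : ∀ j → suc j < 3 → sec 3 (suc j) (X ^ suc j) ≈ Y ^ suc j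
  sec-X^ zero _ = sec-polynomials 2 ρ ρ′ φρ≈ρ′ (v₁ ∷ v₂ :^ 1 ∷ [])
    (trans (^-congˡ 1 X≈) (solve 3 (λ q e z → (e :+ q :* z) :^ 1 := e :+ q :* (z :^ 1 :+ q :* con false)) refl q e Z))
    (s≤s (s≤s z≤n)) 1 (s≤s (s≤s z≤n))
  sec-X^ (suc zero) _ = sec-polynomials 2 ρ ρ′ φρ≈ρ′ (v₁ :^ 2 ∷ con false ∷ v₂ :^ 2 ∷ [])
    (trans (^-congˡ 2 X≈) (solve 3 (λ q e z → (e :+ q :* z) :^ 2 := e :^ 2 :+ q :* (con false :+ q :* (z :^ 2 :+ q :* con false))) refl q e Z))
    (s≤s (s≤s (s≤s z≤n))) 2 (s≤s (s≤s (s≤s z≤n)))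
  sec-X^ (suc (suc j)) (s≤s (s≤s (s≤s ())))

  sec₀-X^ : sec 3 0 (X ^ 3) ≈ X + q * Y ^ 3
  sec₀-X^ = sec-polynomials 2 ρ ρ′ φρ≈ρ′ (v₁ :^ 3 :+ v₀ :* v₂ :^ 3 ∷ v₁ :^ 2 :* v₂ ∷ v₁ :* v₂ :^ 2 ∷ [])
    (trans (^-congˡ 3 X≈) (solve 3 (λ q e z → (e :+ q :* z) :^ 3 :=
      e :^ 3 :+ q :^ 3 :* z :^ 3 :+ q :* (e :^ 2 :* z :+ q :* (e :* z :^ 2 :+ q :* con false))) refl q e Z))
    (s≤s (s≤s (s≤s z≤n))) 0 (s≤s z≤n)

  -- Since X = e + q Z and e³ = φ(E³) = Y, the expansion of D loses the part e (e³ + Y); what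
  -- remains is q times D at q³.
  modular : X ^ 4 ≈ X * Y + q * Y ^ 4
  modular = +≈0⇒≈ (fixed-point-free 2 (begin
    X ^ 4 + (X * Y + q * Y ^ 4)
      ≈⟨ +-cong (^-congˡ 4 X≈) (+-congʳ (*-congʳ X≈)) ⟩
    (e + q * Z) ^ 4 + ((e + q * Z) * Y + q * Y ^ 4)
      ≈⟨ solve 4 (λ q e z y → (e :+ q :* z) :^ 4 :+ ((e :+ q :* z) :* y :+ q :* y :^ 4)
            := e :* (e :^ 3 :+ y) :+ q :* (y :^ 4 :+ (y :* z :+ q :^ 3 :* z :^ 4))) refl q e Z Y ⟩
    e * (e ^ 3 + Y) + q * (Y ^ 4 + (Y * Z + q ^ 3 * Z ^ 4))
      ≈⟨ +-cong (trans (*-congˡ (trans (+-congʳ (sym (φ-^ 2 E 3))) (f+f≈0 Y))) (zeroʳ e)) (*-congˡ (sym φD)) ⟩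
    0# + q * φ 3 (X ^ 4 + (X * Y + q * Y ^ 4))
      ≈⟨ +-identityˡ _ ⟩
    q * φ 3 (X ^ 4 + (X * Y + q * Y ^ 4)) ∎))
    where
    φD : φ 3 (X ^ 4 + (X * Y + q * Y ^ 4)) ≈ Y ^ 4 + (Y * Z + q ^ 3 * Z ^ 4)
    φD = φ-polynomial 2 (v₁ :^ 4 :+ (v₁ :* v₂ :+ v₀ :* v₂ :^ 4)) (q ∷ X ∷ Y ∷ []) (q ^ 3 ∷ Y ∷ Z ∷ [])
      λ { zero → φ-q 2 ; (suc zero) → refl ; (suc (suc zero)) → refl }

module Degree5 where
  open 𝔽₂-Solver

  X Y a z c : 𝔽₂⟦q⟧
  X = E
  Y = φ 5 X
  a = φ 5 A
  z = φ 5 Y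
  c = φ 5 C

  private
    ρ ρ′ : Vec 𝔽₂⟦q⟧ 4
    ρ  = q ∷ A ∷ Y ∷ C ∷ []
    ρ′ = q ^ 5 ∷ a ∷ z ∷ c ∷ []

    φρ≈ρ′ : ∀ i → φ 5 (lookup ρ i) ≈ lookup ρ′ i
    φρ≈ρ′ zero                   = φ-q 4
    φρ≈ρ′ (suc zero)             = refl
    φρ≈ρ′ (suc (suc zero))       = refl
    φρ≈ρ′ (suc (suc (suc zero))) = refl

    v₀ v₁ v₂ v₃ : Polynomial 4
    v₀ = var (# 0)
    v₁ = var (# 1)
    v₂ = var (# 2)
    v₃ = var (# 3)

    X≈ : X ≈ a + q * z + q ^ 2 * c
    X≈ = E-5-dissection

    -- The variable v₀ is q in the sections and q⁵ in X³ itself.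
    cube : List (Polynomial 4)
    cube = v₁ :^ 3 :+ v₀ :* v₂ :* v₃ :^ 2 ∷ v₁ :^ 2 :* v₂ :+ v₀ :* v₃ :^ 3 ∷ v₁ :* (v₁ :* v₃ :+ v₂ :^ 2)
         ∷ v₂ :^ 3 ∷ v₁ :* v₃ :^ 2 :+ v₂ :^ 2 :* v₃ ∷ []

    sec-X³ : ∀ r → r < 5 → sec 5 r (X ^ 3) ≈ nth (List.map (λ P → ⟦ P ⟧ ρ) cube) r
    sec-X³ = sec-polynomials 4 ρ ρ′ φρ≈ρ′ cube
      (trans (^-congˡ 3 X≈) (solve 4 (λ q a z c → (a :+ q :* z :+ q :^ 2 :* c) :^ 3 :=
        a :^ 3 :+ q :^ 5 :* z :* c :^ 2 :+ q :* (a :^ 2 :* z :+ q :^ 5 :* c :^ 3 :+ q :* (a :* (a :* c :+ z :^ 2)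
          :+ q :* (z :^ 3 :+ q :* (a :* c :^ 2 :+ z :^ 2 :* c :+ q :* con false))))) refl q a z c))
      ℕₚ.≤-refl

    theta : List 𝔽₂⟦q⟧
    theta = K ∷ L ∷ 0# ∷ φ 5 (E ^ 3) ∷ []

    sec-X³′ : ∀ r → r < 5 → sec 5 r (X ^ 3) ≈ nth theta r
    sec-X³′ r r<5 = trans (sec-cong 5 r (trans E³-5-dissection (trans
        (solve 4 (λ q k l w → k :+ q :* l :+ q :^ 3 :* w := k :+ q :* (l :+ q :* (con false :+ q :* (w :+ q :* con false))))
          refl q (φ 5 K) (φ 5 L) (φ 5 (φ 5 (E ^ 3))))
        (+-congˡ (*-congˡ (+-congˡ (*-congˡ (+-congʳ (sym (φ-0 4))))))))))
      (sec-interleave 4 theta r (s≤s (s≤s (s≤s (s≤s z≤n)))) r<5)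

    A-unit : A 0 ≡ true
    A-unit = ≡.trans (≡.sym (≡.trans (coeff E≈ 0) (≡.trans (+-coeff _ _ 0)
      (≡.trans (cong (A 0 xor_) (q*-coeff₀ _)) (xor-identityʳ (A 0)))))) E-unit
      where
      E≈ : E ≈ a + q * (z + q * c)
      E≈ = trans X≈ (solve 4 (λ q a z c → a :+ q :* z :+ q :^ 2 :* c := a :+ q :* (z :+ q :* c)) refl q a z c)

    -- No triangular number is 2 modulo 5.
    AC+Y²≈0 : A * C + Y ^ 2 ≈ 0#
    AC+Y²≈0 = *-cancelˡ A A-unit (begin
      A * (A * C + Y ^ 2)   ≈⟨ sec-X³ 2 (s≤s (s≤s (s≤s z≤n))) ⟨
      sec 5 2 (X ^ 3)       ≈⟨ sec-X³′ 2 (s≤s (s≤s (s≤s z≤n))) ⟩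
      0#                    ≈⟨ zeroʳ A ⟨
      A * 0#                ∎)

    Y-unit : Y 0 ≡ true
    Y-unit = E-unit

    A⁵+q²C⁵≈X : A ^ 5 + q ^ 2 * C ^ 5 ≈ X
    A⁵+q²C⁵≈X = *-cancelˡ Y Y-unit (begin
      Y * (A ^ 5 + q ^ 2 * C ^ 5)
        ≈⟨ +-identityʳ _ ⟨
      Y * (A ^ 5 + q ^ 2 * C ^ 5) + 0#
        ≈⟨ +-congˡ (trans (*-congˡ AC+Y²≈0) (zeroʳ _)) ⟨
      -- The added multiple of A C + Y² consists of the cross terms in the product of sections 0 and
      -- 1 of X³.
      Y * (A ^ 5 + q ^ 2 * C ^ 5) + q * A ^ 2 * C ^ 2 * (A * C + Y ^ 2)
        ≈⟨ solve 4 (λ q a y c → y :* (a :^ 5 :+ q :^ 2 :* c :^ 5) :+ q :* a :^ 2 :* c :^ 2 :* (a :* c :+ y :^ 2)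
              := (a :^ 3 :+ q :* y :* c :^ 2) :* (a :^ 2 :* y :+ q :* c :^ 3)) refl q A Y C ⟩
      (A ^ 3 + q * Y * C ^ 2) * (A ^ 2 * Y + q * C ^ 3)
        ≈⟨ *-cong (trans (sym (sec-X³ 0 (s≤s z≤n))) (sec-X³′ 0 (s≤s z≤n)))
                  (trans (sym (sec-X³ 1 (s≤s (s≤s z≤n)))) (sec-X³′ 1 (s≤s (s≤s z≤n)))) ⟩
      K * L
        ≈⟨ trans KL≈Eφ₅E (*-comm X Y) ⟩
      Y * X ∎)

  -- Modulo 2 the series X² and X⁴ consist of pure powers of the three parts of X. In class 3 of X³
  -- the product of all three parts has coefficient 6, so only z³ survives.
  sec-X^ : ∀ j → suc j < 5 → sec 5 (suc j) (X ^ suc j) ≈ Y ^ suc j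
  sec-X^ zero _ = sec-polynomials 4 ρ ρ′ φρ≈ρ′ (v₁ ∷ v₂ :^ 1 ∷ v₃ ∷ [])
    (trans (^-congˡ 1 X≈) (solve 4 (λ q a z c → (a :+ q :* z :+ q :^ 2 :* c) :^ 1
      := a :+ q :* (z :^ 1 :+ q :* (c :+ q :* con false))) refl q a z c))
    (s≤s (s≤s (s≤s z≤n))) 1 (s≤s (s≤s z≤n))
  sec-X^ (suc zero) _ = sec-polynomials 4 ρ ρ′ φρ≈ρ′ (v₁ :^ 2 ∷ con false ∷ v₂ :^ 2 ∷ con false ∷ v₃ :^ 2 ∷ [])
    (trans (^-congˡ 2 X≈) (solve 4 (λ q a z c → (a :+ q :* z :+ q :^ 2 :* c) :^ 2
      := a :^ 2 :+ q :* (con false :+ q :* (z :^ 2 :+ q :* (con false :+ q :* (c :^ 2 :+ q :* con false))))) refl q a z c))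
    ℕₚ.≤-refl 2 (s≤s (s≤s (s≤s z≤n)))
  sec-X^ (suc (suc zero)) 3<5 = sec-X³ 3 3<5
  sec-X^ (suc (suc (suc zero))) 4<5 = sec-polynomials 4 ρ ρ′ φρ≈ρ′ (v₁ :^ 4 ∷ con false ∷ con false ∷ v₀ :* v₃ :^ 4 ∷ v₂ :^ 4 ∷ [])
    (trans (^-congˡ 4 X≈) (solve 4 (λ q a z c → (a :+ q :* z :+ q :^ 2 :* c) :^ 4
      := a :^ 4 :+ q :* (con false :+ q :* (con false :+ q :* (q :^ 5 :* c :^ 4 :+ q :* (z :^ 4 :+ q :* con false))))) refl q a z c))
    ℕₚ.≤-refl 4 4<5
  sec-X^ (suc (suc (suc (suc j)))) (s≤s (s≤s (s≤s (s≤s (s≤s ())))))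

  sec₀-X^ : sec 5 0 (X ^ 5) ≈ X + q * Y ^ 5
  sec₀-X^ = trans (sec-polynomials 4 ρ ρ′ φρ≈ρ′
      (v₁ :^ 5 :+ v₀ :^ 2 :* v₃ :^ 5 :+ v₀ :* v₂ :^ 5 ∷ v₁ :^ 4 :* v₂ :+ v₀ :* v₂ :^ 4 :* v₃ ∷ v₁ :^ 4 :* v₃
        ∷ v₀ :* v₃ :^ 4 :* v₁ ∷ v₂ :^ 4 :* v₁ :+ v₀ :* v₃ :^ 4 :* v₂ ∷ [])
      (trans (^-congˡ 5 X≈) (solve 4 (λ q a z c → (a :+ q :* z :+ q :^ 2 :* c) :^ 5
        := a :^ 5 :+ (q :^ 5) :^ 2 :* c :^ 5 :+ q :^ 5 :* z :^ 5 :+ q :* (a :^ 4 :* z :+ q :^ 5 :* z :^ 4 :* c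
          :+ q :* (a :^ 4 :* c :+ q :* (q :^ 5 :* c :^ 4 :* a :+ q :* (z :^ 4 :* a :+ q :^ 5 :* c :^ 4 :* z :+ q :* con false))))) refl q a z c))
      ℕₚ.≤-refl 0 (s≤s z≤n))
    (+-congʳ A⁵+q²C⁵≈X)

  -- Expanding X⁶ as X⁴ X² and collecting multiples of a⁵ + q¹⁰ c⁵ + Y and a c + z², the two
  -- relations at q⁵, leaves q times D at q⁵.
  modular : X ^ 6 ≈ X * Y + q * Y ^ 6
  modular = +≈0⇒≈ (fixed-point-free 4 (begin
    X ^ 6 + (X * Y + q * Y ^ 6)
      ≈⟨ +-cong (^-congˡ 6 X≈) (+-congʳ (*-congʳ X≈)) ⟩
    (a + q * z + q ^ 2 * c) ^ 6 + ((a + q * z + q ^ 2 * c) * Y + q * Y ^ 6)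
      ≈⟨ solve 5 (λ q a z c y → (a :+ q :* z :+ q :^ 2 :* c) :^ 6 :+ ((a :+ q :* z :+ q :^ 2 :* c) :* y :+ q :* y :^ 6)
            := (a :+ q :^ 2 :* c) :* (a :^ 5 :+ (q :^ 5) :^ 2 :* c :^ 5 :+ y)
               :+ (q :^ 2 :* (a :^ 4 :+ q :^ 8 :* c :^ 4) :+ q :^ 4 :* (a :^ 2 :+ q :^ 4 :* c :^ 2) :* (a :* c :+ z :^ 2)) :* (a :* c :+ z :^ 2)
               :+ q :* (y :^ 6 :+ (y :* z :+ q :^ 5 :* z :^ 6))) refl q a z c Y ⟩
    (a + q ^ 2 * c) * (a ^ 5 + (q ^ 5) ^ 2 * c ^ 5 + Y)
      + (q ^ 2 * (a ^ 4 + q ^ 8 * c ^ 4) + q ^ 4 * (a ^ 2 + q ^ 4 * c ^ 2) * (a * c + z ^ 2)) * (a * c + z ^ 2)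
      + q * (Y ^ 6 + (Y * z + q ^ 5 * z ^ 6))
      ≈⟨ +-cong (+-cong (trans (*-congˡ (trans (+-congʳ φ-A⁵+q²C⁵≈X) (f+f≈0 Y))) (zeroʳ _)) (trans (*-congˡ φ-AC+Y²≈0) (zeroʳ _))) (*-congˡ (sym φD)) ⟩
    0# + 0# + q * φ 5 (X ^ 6 + (X * Y + q * Y ^ 6))
      ≈⟨ trans (+-congʳ (+-identityˡ 0#)) (+-identityˡ _) ⟩
    q * φ 5 (X ^ 6 + (X * Y + q * Y ^ 6)) ∎))
    where
    φ-A⁵+q²C⁵≈X : a ^ 5 + (q ^ 5) ^ 2 * c ^ 5 ≈ Y
    φ-A⁵+q²C⁵≈X = trans (sym (φ-polynomial 4 (v₁ :^ 5 :+ v₀ :^ 2 :* v₃ :^ 5) ρ ρ′ φρ≈ρ′)) (φ-cong 4 A⁵+q²C⁵≈X)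
    φ-AC+Y²≈0 : a * c + z ^ 2 ≈ 0#
    φ-AC+Y²≈0 = trans (sym (φ-polynomial 4 (v₁ :* v₃ :+ v₂ :^ 2) ρ ρ′ φρ≈ρ′)) (trans (φ-cong 4 AC+Y²≈0) (φ-0 4))
    φD : φ 5 (X ^ 6 + (X * Y + q * Y ^ 6)) ≈ Y ^ 6 + (Y * z + q ^ 5 * z ^ 6)
    φD = φ-polynomial 4 (v₁ :^ 6 :+ (v₁ :* v₂ :+ v₀ :* v₂ :^ 6)) (q ∷ X ∷ Y ∷ 0# ∷ []) (q ^ 5 ∷ Y ∷ z ∷ 0# ∷ [])
      λ { zero → φ-q 4 ; (suc zero) → refl ; (suc (suc zero)) → refl ; (suc (suc (suc zero))) → φ-0 4 }

-- Reduction modulo 2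

parity : ℕ → Bool
parity zero    = false
parity (suc n) = not (parity n)

parity-+ : ∀ m n → parity (m ℕ.+ n) ≡ parity m xor parity n
parity-+ zero    n = ≡.refl
parity-+ (suc m) n = ≡.trans (cong not (parity-+ m n)) (not-distribˡ-xor (parity m) (parity n))

parity-* : ∀ m n → parity (m ℕ.* n) ≡ parity m ∧ parity n
parity-* zero    n = ≡.refl
parity-* (suc m) n = ≡.trans (parity-+ n (m ℕ.* n)) (≡.trans (cong (parity n xor_) (parity-* m n)) (step (parity m) (parity n)))
  where
  step : ∀ a b → b xor (a ∧ b) ≡ not a ∧ b
  step false b     = xor-identityʳ b
  step true  false = ≡.refl
  step true  true  = ≡.refl

%2≡parity : ∀ n → n ℕ.% 2 ≡ (if parity n then 1 else 0)
%2≡parity zero          = ≡.refl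
%2≡parity (suc zero)    = ≡.refl
%2≡parity (suc (suc n)) = ≡.trans (%2≡parity n) (cong (if_then 1 else 0) (≡.sym (not-involutive (parity n))))

mod2 : Series → 𝔽₂⟦q⟧
mod2 f n = parity (f n)

mod2-reflects : ∀ f g → mod2 f ≈ mod2 g → f ≡[mod2] g
mod2-reflects f g e n = ≡.trans (%2≡parity (f n)) (≡.trans (cong (if_then 1 else 0) (coeff e n)) (≡.sym (%2≡parity (g n))))

mod2-⊕ : ∀ f g → mod2 (f ⊕ g) ≈ mod2 f + mod2 g
mod2-⊕ f g = coeffwise λ n → ≡.trans (parity-+ (f n) (g n)) (≡.sym (+-coeff _ _ n))

mod2-one : mod2 one ≈ 1#
mod2-one = coeffwise λ { zero → ≡.sym 1#-coeff₀ ; (suc n) → ≡.sym (1#-coeff₊ n) }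

sumUpTo-first : ∀ m u → sumUpTo (suc m) u ≡ u 0 ℕ.+ sumUpTo m (u ∘ suc)
sumUpTo-first zero    u = ≡.refl
sumUpTo-first (suc m) u = ≡.trans (cong (ℕ._+ u (suc (suc m))) (sumUpTo-first m u)) (ℕₚ.+-assoc (u 0) _ _)

mod2-⋆ : ∀ f g → mod2 (f ⋆ g) ≈ mod2 f * mod2 g
mod2-⋆ f g = coeffwise (at f)
  where
  at : ∀ f n → mod2 (f ⋆ g) n ≡ (mod2 f * mod2 g) n
  at f zero    = ≡.trans (parity-* (f 0) (g 0)) (≡.sym (*-coeff₀ _ _))
  at f (suc n) = ≡.trans (cong parity (sumUpTo-first n (λ k → f k ℕ.* g (suc n ℕ.∸ k))))
    (≡.trans (parity-+ (f 0 ℕ.* g (suc n)) _)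
    (≡.trans (cong₂ _xor_ (parity-* (f 0) (g (suc n))) (at (f ∘ suc) n)) (≡.sym (*-coeff₊ _ _ n))))

mod2-pow : ∀ f t → mod2 (pow f t) ≈ mod2 f ^ t
mod2-pow f zero    = mod2-one
mod2-pow f (suc t) = trans (mod2-⋆ f (pow f t)) (*-congˡ (mod2-pow f t))

mod2-shift : ∀ s f → mod2 (shift s f) ≈ q ^ s * mod2 f
mod2-shift zero    f = sym (*-identityˡ _)
mod2-shift (suc s) f = trans (coeffwise λ { zero → ≡.sym (q*-coeff₀ _) ; (suc n) → ≡.sym (q*-coeff₊ _ n) })
  (trans (*-congˡ (mod2-shift s f)) (sym (*-assoc q (q ^ s) (mod2 f))))

-- The functional equation of 1 / (1 - qᵈ). It is the only fact about `geom` that the infinite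
-- products below use.
mod2-geom : ∀ d .{{_ : NonZero d}} → mod2 (geom d) ≈ 1# + q ^ d * mod2 (geom d)
mod2-geom d = coeffwise λ n → ≡.trans (at n) (≡.sym (+-coeff _ _ n))
  where
  periodic : ∀ m → geom d (d ℕ.+ m) ≡ geom d m
  periodic m with d ∣? (d ℕ.+ m) | d ∣? m
  ... | yes _     | yes _   = ≡.refl
  ... | no _      | no _    = ≡.refl
  ... | yes d∣d+m | no d∤m  = contradiction (∣m+n∣m⇒∣n d∣d+m ∣-refl) d∤m
  ... | no d∤d+m  | yes d∣m = contradiction (∣m∣n⇒∣m+n ∣-refl d∣m) d∤d+m

  initial : ∀ n → n < d → mod2 (geom d) n ≡ 1# n
  initial zero    _   with d ∣? 0
  ... | yes _  = ≡.sym 1#-coeff₀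
  ... | no d∤0 = contradiction (d ∣0) d∤0
  initial (suc n) n<d with d ∣? suc n
  ... | yes d∣n = contradiction d∣n (>⇒∤ n<d)
  ... | no _    = ≡.sym (1#-coeff₊ n)

  at : ∀ n → mod2 (geom d) n ≡ 1# n xor (q ^ d * mod2 (geom d)) n
  at n with ℕₚ.<-≤-connex n d
  ... | inj₁ n<d = ≡.trans (initial n n<d) (≡.sym (≡.trans (cong (1# n xor_)
          (≡.trans (coeff-< (q^*≈0 d (mod2 (geom d))) n n<d) (0#-coeff n))) (xor-identityʳ (1# n))))
  ... | inj₂ d≤n with ℕₚ.m≤n⇒∃[o]m+o≡n d≤n
  ...   | m , ≡.refl = ≡.trans (cong parity (periodic m)) (≡.sym (≡.trans
          (cong₂ _xor_ (1#-coeff-d+ d m) (q^*-coeff d (mod2 (geom d)) m)) ≡.refl))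
    where
    1#-coeff-d+ : ∀ d m .{{_ : NonZero d}} → 1# (d ℕ.+ m) ≡ false
    1#-coeff-d+ (suc d) m = 1#-coeff₊ (d ℕ.+ m)

module _ (a : ℕ) .{{_ : NonZero a}} where

  private
    instance
      a*suc≢0 : ∀ {n} → NonZero (a ℕ.* suc n)
      a*suc≢0 {n} = ℕₚ.m*n≢0 a (suc n)

    g : ℕ → 𝔽₂⟦q⟧
    g n = mod2 (geom (a ℕ.* suc n))

    g≈1 : ∀ n → g n ≈[ suc n ] 1#
    g≈1 n = ≈[]-weaken (ℕₚ.m≤n*m (suc n) a) (≈[]-trans (≈⇒≈[] (mod2-geom (a ℕ.* suc n)))
      (≈[]-trans (+-cong-[] (≈⇒≈[] refl) (q^*≈0 (a ℕ.* suc n) _)) (≈⇒≈[] (+-identityʳ 1#))))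

    g-convergent : ∏.Convergent g
    g-convergent n = ≈[]-weaken (ℕₚ.n≤1+n n) (g≈1 n)

    mod2-truncInvProd : ∀ N t → mod2 (truncInvProd N a t) ≈ ∏.fold (λ n → g n ^ t) N
    mod2-truncInvProd zero    t = mod2-one
    mod2-truncInvProd (suc N) t = trans (mod2-⋆ (truncInvProd N a t) (pow (geom (a ℕ.* suc N)) t)) (trans (*-comm _ _)
      (*-cong (mod2-pow (geom (a ℕ.* suc N)) t) (mod2-truncInvProd N t)))

  G : 𝔽₂⟦q⟧
  G = ∏.inf g

  mod2-invProd : ∀ t → mod2 (invProd a t) ≈ G ^ t
  mod2-invProd t = trans (coeffwise at) (sym (∏.inf-homomorphic (_^ t) (^-cong-[] t) (1^n≈1 t) (λ f f′ → ^-distrib-* f f′ t) g-convergent))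
    where
    at : ∀ n → mod2 (invProd a t) n ≡ ∏.inf (λ n → g n ^ t) n
    -- `invProd` reads coefficient n after n factors, `∏.inf` after n + 1. The extra factor is 1
    -- modulo qⁿ⁺¹, one order more than `Convergent` provides.
    at n = ≡.trans (coeff (mod2-truncInvProd n t) n) (≡.sym (coeff-< (≈[]-trans
      (*-cong-[] (≈[]-trans (^-cong-[] t (g≈1 n)) (≈⇒≈[] (1^n≈1 t))) (≈⇒≈[] refl)) (≈⇒≈[] (*-identityˡ _))) n ℕₚ.≤-refl))

  G*P≈1 : G * P a a ≈ 1#
  G*P≈1 = trans (sym (∏.inf-∙ g-convergent (factor-convergent a a))) (trans (∏.inf-cong inverse) ∏.inf-ε)
    where
    open 𝔽₂-Solver
    inverse : ∀ n → g n * factor a a n ≈ 1#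
    inverse n = begin
      g n * (1# + q ^ (a ℕ.+ n ℕ.* a))
        ≈⟨ *-congˡ (+-congˡ (^-congʳ q (≡.trans (cong (a ℕ.+_) (ℕₚ.*-comm n a)) (≡.sym (ℕₚ.*-suc a n))))) ⟩
      g n * (1# + u)
        ≈⟨ solve 2 (λ g u → g :* (con true :+ u) := g :+ u :* g) refl (g n) u ⟩
      g n + u * g n
        ≈⟨ +-congʳ (mod2-geom (a ℕ.* suc n)) ⟩
      1# + u * g n + u * g n
        ≈⟨ solve 2 (λ g u → con true :+ u :* g :+ u :* g := con true) refl (g n) u ⟩
      1# ∎
      where
      u : 𝔽₂⟦q⟧
      u = q ^ (a ℕ.* suc n)

-- The congruence for the two triples

module _ (p′ t : ℕ) where

  private
    a : ℕ
    a = suc p′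

  -- The index hypothesis says b = a² - 1, in the form of two nested sections of class a - 1. The
  -- inverses of X and of X(qᵃ) are the t-th powers of `G 1` and `G a`.
  congruence : ∀ b X → X ≈ E ^ t → (∀ n → a ℕ.^ 2 ℕ.* n ℕ.+ b ≡ p′ ℕ.+ (p′ ℕ.+ n ℕ.* a) ℕ.* a) →
    X ^ suc a ≈ X * φ a X + q * φ a X ^ suc a →
    (∀ j → suc j < a → sec a (suc j) (X ^ suc j) ≈ φ a X ^ suc j) →
    sec a 0 (X ^ a) ≈ X + q * φ a X ^ a →
    Congruence a b t
  congruence b X X≈Eᵗ index modular sec-X^ sec₀-X^ = mod2-reflects (shift 2 (λ n → p t (a ℕ.^ 2 ℕ.* n ℕ.+ b))) ((invProd 1 (a ℕ.^ 2 ℕ.* t) ⊕ invProd a (a ℕ.* t)) ⊕ shift 1 (invProd 1 t)) (begin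
    mod2 (shift 2 (λ n → p t (a ℕ.^ 2 ℕ.* n ℕ.+ b)))
      ≈⟨ mod2-shift 2 _ ⟩
    q ^ 2 * mod2 (λ n → p t (a ℕ.^ 2 ℕ.* n ℕ.+ b))
      ≈⟨ *-congˡ (coeffwise λ n → cong (mod2 (p t)) (index n)) ⟩
    q ^ 2 * sec a p′ (sec a p′ (mod2 (p t)))
      ≈⟨ *-congˡ (sec-cong a p′ (sec-cong a p′ (mod2-invProd 1 t))) ⟩
    q ^ 2 * sec a p′ (sec a p′ (G 1 ^ t))
      ≈⟨ sec-sec p′ X (G 1 ^ t) (G a ^ t) (trans (*-congˡ X≈Eᵗ) (inverse-^ t (G*P≈1 1)))
           (trans (*-congˡ (trans (φ-cong p′ X≈Eᵗ) (trans (φ-^ p′ E t) (^-congˡ t (φ-E p′))))) (inverse-^ t (G*P≈1 a))) modular sec-X^ sec₀-X^ ⟩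
    (G 1 ^ t) ^ (a ℕ.* a) + (G a ^ t) ^ a + q * G 1 ^ t
      ≈⟨ +-cong (+-cong (power 1 (a ℕ.* a) (a ℕ.^ 2 ℕ.* t) (cong (ℕ._* t) (cong (a ℕ.*_) (≡.sym (ℕₚ.*-identityʳ a))))) (power a a (a ℕ.* t) ≡.refl))
                (trans (*-cong (sym (*-identityʳ q)) (sym (mod2-invProd 1 t))) (sym (mod2-shift 1 (invProd 1 t)))) ⟩
    mod2 (invProd 1 (a ℕ.^ 2 ℕ.* t)) + mod2 (invProd a (a ℕ.* t)) + mod2 (shift 1 (invProd 1 t))
      ≈⟨ trans (mod2-⊕ (invProd 1 (a ℕ.^ 2 ℕ.* t) ⊕ invProd a (a ℕ.* t)) (shift 1 (invProd 1 t))) (+-congʳ (mod2-⊕ (invProd 1 (a ℕ.^ 2 ℕ.* t)) (invProd a (a ℕ.* t)))) ⟨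
    mod2 ((invProd 1 (a ℕ.^ 2 ℕ.* t) ⊕ invProd a (a ℕ.* t)) ⊕ shift 1 (invProd 1 t)) ∎)
    where
    power : ∀ c .{{_ : NonZero c}} m k → m ℕ.* t ≡ k → (G c ^ t) ^ m ≈ mod2 (invProd c k)
    power c m k e = trans (^-assocʳ (G c) t m) (trans (^-congʳ (G c) (≡.trans (ℕₚ.*-comm t m) e)) (sym (mod2-invProd c k)))

theorem1p4 : Congruence 3 8 3 × Congruence 5 24 1
theorem1p4 =
  congruence 2 3 8 Degree3.X refl (solve 1 (λ n → con 9 :* n :+ con 8 := con 2 :+ (con 2 :+ n :* con 3) :* con 3) ≡.refl)
    Degree3.modular Degree3.sec-X^ Degree3.sec₀-X^ ,
  congruence 4 1 24 Degree5.X (sym (*-identityʳ E)) (solve 1 (λ n → con 25 :* n :+ con 24 := con 4 :+ (con 4 :+ n :* con 5) :* con 5) ≡.refl)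
    Degree5.modular Degree5.sec-X^ Degree5.sec₀-X^
  where open Data.Nat.Solver.+-*-Solver
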